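{- A tree $T$ satisfies $\gamma(T)=\gamma_{t2}(T)$ if and only if $T\in\mathscr{O}$.
   Context: All trees considered have at least two vertices. $\gamma(G)$ is the domination number of $G$ (minimum size of a set $S$ such that every vertex outside $S$ has a neighbor in $S$). A set $D\subseteq V(G)$ is a semitotal dominating set if it is dominating and every vertex of $D$ is at distance at most $2$ from some other vertex of $D$; $\gamma_{t2}(G)$ is the minimum cardinality of such a set, and a $\gamma_{t2}(G)$-set is one of that cardinality. An almost dominating set of $G$ relative to a vertex $v$ is a set dominating all vertices of $G$ except possibly $v$; $\gamma(G;v)$ is the minimum cardinality of such a set. $P_k$ denotes the path on $k$ vertices. For $t\ge 2$, a subdivided star $X$ with $t$ leaves is obtained from the star $K_{1,t}$ with center $x$ by subdividing every edge once. $Y$ with three leaves denotes the tree obtained from the star $K_{1,3}$ with center $x$ by subdividing exactly one edge once (so $x$ has two leaf-neighbors). The operations on a tree $T$ are: $\mathscr{O}_1$: add a new vertex and join it to a vertex of $T$ that lies in some $\gamma_{t2}(T)$-set. $\mathscr{O}_2$: add a new path $P_2$ or $P_5$ and join one of its leaves (end vertices) to a vertex $v$ of $T$ with $\gamma(T;v)=\gamma(T)$. $\mathscr{O}_3$: add a subdivided star $X$ with at least two leaves and join its center $x$ to a vertex of $T$. $\mathscr{O}_4$: add a copy of $Y$ with three leaves and join a leaf-neighbor of its center $x$ to a vertex of $T$. $\mathscr{O}$ is the family of trees obtained from $P_4$ by a finite sequence (possibly empty) of these operations. -}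

module Defs where

open import Data.Bool using (Bool; true; false; _∧_; _∨_; if_then_else_)
open import Data.Nat as ℕ using (ℕ; zero; suc; _+_; _*_; _∸_; _≤_; _≡ᵇ_)
open import Data.Fin as Fin using (Fin; zero; suc; toℕ; splitAt; _≟_)
open import Data.Fin.Subset using (Subset; _∈_; _∉_; ∣_∣)
open import Data.Vec using (tabulate; sum)
open import Data.Sum using (_⊎_; inj₁; inj₂)
open import Data.Product using (Σ; ∃; ∃-syntax; _×_; _,_)
open import Relation.Nullary using (¬_; does)
open import Relation.Binary.PropositionalEquality using (_≡_; _≢_)
open import Relation.Binary.Construct.Closure.ReflexiveTransitive using (Star)
open import Function.Bundles using (_↔_; Inverse)

Graph : ℕ → Set
Graph n = Fin n → Fin n → Bool

Adj : ∀ {n} → Graph n → Fin n → Fin n → Set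
Adj G u v = G u v ≡ true

degree : ∀ {n} → Graph n → Fin n → ℕ
degree G v = ∣ tabulate (G v) ∣

-- sum of degrees = twice the number of edges
degreeSum : ∀ {n} → Graph n → ℕ
degreeSum {n} G = sum (tabulate (degree G))

Connected : ∀ {n} → Graph n → Set
Connected G = ∀ u v → Star (Adj G) u v

record IsTree {n : ℕ} (G : Graph n) : Set where
  field
    atLeastTwo : 2 ≤ n
    symmetric  : ∀ u v → G u v ≡ G v u
    irreflexive : ∀ v → G v v ≡ false
    connected  : Connected G
    edgeCount  : degreeSum G ≡ 2 * (n ∸ 1)

Dominating : ∀ {n} → Graph n → Subset n → Set
Dominating G S = ∀ w → w ∉ S → ∃[ u ] (u ∈ S × Adj G u w)

-- distance at most 2 (for distinct vertices): adjacent or common neighbour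
Within2 : ∀ {n} → Graph n → Fin n → Fin n → Set
Within2 G u w = Adj G u w ⊎ (∃[ x ] (Adj G u x × Adj G x w))

SemitotalDominating : ∀ {n} → Graph n → Subset n → Set
SemitotalDominating G S =
  Dominating G S × (∀ u → u ∈ S → ∃[ w ] (w ∈ S × u ≢ w × Within2 G u w))

AlmostDominating : ∀ {n} → Graph n → Fin n → Subset n → Set
AlmostDominating G v S = ∀ w → w ≢ v → w ∉ S → ∃[ u ] (u ∈ S × Adj G u w)

IsMinCard : ∀ {n} → (Subset n → Set) → ℕ → Set
IsMinCard P k = (∃[ S ] (P S × ∣ S ∣ ≡ k)) × (∀ S → P S → k ≤ ∣ S ∣)

IsDomNumber : ∀ {n} → Graph n → ℕ → Set
IsDomNumber G = IsMinCard (Dominating G)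

IsSemitotalDomNumber : ∀ {n} → Graph n → ℕ → Set
IsSemitotalDomNumber G = IsMinCard (SemitotalDominating G)

IsAlmostDomNumber : ∀ {n} → Graph n → Fin n → ℕ → Set
IsAlmostDomNumber G v = IsMinCard (AlmostDominating G v)

GammaEqGammaT2 : ∀ {n} → Graph n → Set
GammaEqGammaT2 G = ∃[ k ] (IsDomNumber G k × IsSemitotalDomNumber G k)

AlmostEqGamma : ∀ {n} → Graph n → Fin n → Set
AlmostEqGamma G v = ∃[ k ] (IsDomNumber G k × IsAlmostDomNumber G v k)

IsGammaT2Set : ∀ {n} → Graph n → Subset n → Set
IsGammaT2Set G S = SemitotalDominating G S × (∀ S′ → SemitotalDominating G S′ → ∣ S ∣ ≤ ∣ S′ ∣)

InSomeGammaT2Set : ∀ {n} → Graph n → Fin n → Set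
InSomeGammaT2Set G v = ∃[ S ] (IsGammaT2Set G S × v ∈ S)

_==_ : ∀ {n} → Fin n → Fin n → Bool
i == j = does (i ≟ j)

attach : ∀ {n m} → Graph n → Graph m → Fin n → Fin m → Graph (n + m)
attach {n} G H v h i j with splitAt n i | splitAt n j
... | inj₁ a | inj₁ b = G a b
... | inj₂ a | inj₂ b = H a b
... | inj₁ a | inj₂ b = (a == v) ∧ (b == h)
... | inj₂ a | inj₁ b = (b == v) ∧ (a == h)

K1 : Graph 1
K1 _ _ = false

path : (k : ℕ) → Graph k
path k i j = ((toℕ i + 1) ≡ᵇ toℕ j) ∨ ((toℕ j + 1) ≡ᵇ toℕ i)

data XVertex (t : ℕ) : Set where
  center : XVertex t
  mid    : Fin t → XVertex t
  leaf   : Fin t → XVertex t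

xVertex : ∀ {t} → Fin (suc (t + t)) → XVertex t
xVertex zero = center
xVertex {t} (suc i) with splitAt t i
... | inj₁ a = mid a
... | inj₂ a = leaf a

xAdj : ∀ {t} → XVertex t → XVertex t → Bool
xAdj center  (mid b)  = true
xAdj (mid a) center   = true
xAdj (mid a) (leaf b) = a == b
xAdj (leaf a) (mid b) = a == b
xAdj _ _ = false

subdividedStar : (t : ℕ) → Graph (suc (t + t))
subdividedStar t i j = xAdj (xVertex {t} i) (xVertex {t} j)

xCenter : (t : ℕ) → Fin (suc (t + t))
xCenter t = zero

-- Y: K_{1,3} with center x and exactly one edge subdivided.
-- Vertices: 0 = a (leaf-neighbour of x), 1 = x, 2 = b (leaf-neighbour of x),
-- 3 = c (subdivision vertex), 4 = d (leaf adjacent to c).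
-- Edges: 0–1, 1–2, 1–3, 3–4.
yEdge : Fin 5 → Fin 5 → Bool
yEdge i j = ((toℕ i ≡ᵇ 0) ∧ (toℕ j ≡ᵇ 1))
          ∨ ((toℕ i ≡ᵇ 1) ∧ (toℕ j ≡ᵇ 2))
          ∨ ((toℕ i ≡ᵇ 1) ∧ (toℕ j ≡ᵇ 3))
          ∨ ((toℕ i ≡ᵇ 3) ∧ (toℕ j ≡ᵇ 4))

Ygraph : Graph 5
Ygraph i j = yEdge i j ∨ yEdge j i

-- a leaf-neighbour of the center of Y
yAttach : Fin 5
yAttach = zero

record Iso {n m : ℕ} (G : Graph n) (H : Graph m) : Set where
  field
    bij      : Fin n ↔ Fin m
    preserve : ∀ i j → G i j ≡ H (Inverse.to bij i) (Inverse.to bij j)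

data InO : {n : ℕ} → Graph n → Set where
  base : InO (path 4)
  op1  : ∀ {n} {T : Graph n} → InO T → (v : Fin n) → InSomeGammaT2Set T v →
         InO (attach T K1 v zero)
  op2a : ∀ {n} {T : Graph n} → InO T → (v : Fin n) → AlmostEqGamma T v →
         InO (attach T (path 2) v zero)
  op2b : ∀ {n} {T : Graph n} → InO T → (v : Fin n) → AlmostEqGamma T v →
         InO (attach T (path 5) v zero)
  op3  : ∀ {n} {T : Graph n} → InO T → (t : ℕ) → 2 ≤ t → (v : Fin n) →
         InO (attach T (subdividedStar t) v (xCenter t))
  op4  : ∀ {n} {T : Graph n} → InO T → (v : Fin n) →
         InO (attach T Ygraph v yAttach)
  iso  : ∀ {n m} {T : Graph n} {T′ : Graph m} → InO T → Iso T T′ → InO T′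

{-# OPTIONS --safe #-}

-- Each operation raises γ by at least some d (0 for 𝒪₁, γ(H) when a piece H is added otherwise), while a suitable
-- semitotal γ-set of the old tree extends by d vertices. So equality of the two numbers is preserved.
--
-- Conversely let D be a semitotal dominating set of T with |D| = γ(T). If T arises from T′ by adding H, and T′ has a
-- semitotal dominating set of size |D| − γ(H), then γ(T′) = γt2(T′), and the side condition γ(T′;v) = γ(T′) of 𝒪₂ comes
-- for free, because an almost dominating set of T′ and a γ-set of H through the attachment vertex dominate T.
-- Root T and scan it bottom-up. The rest of the tree acts on a subtree only through the existence of members of D at
-- distance 1 and 2 from the root of the subtree. Exchanging members of D towards the root when possible, every
-- subtree either exposes a removable piece (P₂, P₅, subdivided star with two leaves, Y, or a leaf) or is one of ten
-- configurations with at most five vertices; when the scan reaches the root of T, T itself is one of these.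
module Submission where

open import Defs
import Data.Bool as Bool
open import Data.Bool using (Bool; true; false; _∧_; _∨_; not; if_then_else_; T)
open import Data.Bool.Properties using (∧-zeroʳ; ∧-identityʳ; ∨-comm; ∨-identityʳ; ∨-zeroʳ)
open import Data.Empty using (⊥-elim)
open import Data.Fin using (Fin; zero; suc; toℕ; splitAt; join; punchIn; punchOut; _↑ˡ_; _↑ʳ_; _≟_)
open import Data.Fin.Patterns using (0F; 1F; 2F; 3F; 4F)
open import Data.Fin.Properties
  using (splitAt-↑ˡ; splitAt-↑ʳ; join-splitAt; +↔⊎; ↑ˡ-injective; ↑ʳ-injective; punchInᵢ≢i; punchIn-punchOut;
         punchOut-punchIn; punchIn-injective; any?; all?)
  renaming (suc-injective to Fin-suc-injective)
open import Data.Fin.Subset using (Subset; ∣_∣; inside; outside; _∈_; _∉_)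
open import Data.Fin.Subset.Properties using (∣⊤∣≡n; ∣⊥∣≡0)
open import Data.Nat using (ℕ; zero; suc; _+_; _*_; _≤_; _<_; z≤n; s≤s; _≤?_; _≤ᵇ_; _≡ᵇ_)
open import Data.Nat.Properties hiding (_≟_; ≡-irrelevant)
open import Algebra.Properties.CommutativeSemigroup +-commutativeSemigroup using (x∙yz≈y∙xz)
open import Algebra.Properties.CommutativeMonoid.Sum +-0-commutativeMonoid
  using (sum; sum-remove; ∑-distrib-+; sum-cong-≗; sum-permute)
open import Data.Product using (∃-syntax; _×_; _,_; proj₁; proj₂)
open import Data.Sum as Sum using (_⊎_; inj₁; inj₂; [_,_]′)
open import Data.Sum.Function.Propositional using (_⊎-↔_)
import Data.Vec as Vec
open import Data.Vec using ([]; _∷_; lookup; _++_; tabulate; replicate; _[_]≔_)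
open import Data.Vec.Properties
  using (lookup-++ˡ; lookup-++ʳ; []=⇒lookup; lookup⇒[]=; lookup∘tabulate; tabulate∘lookup; lookup-replicate;
         lookup∘update; lookup∘update′)
open import Function using (_∘_; id; const)
open import Function.Bundles using (_↔_; Inverse; mk↔ₛ′; _⇔_; mk⇔; Equivalence)
open import Function.Construct.Composition using (_↔-∘_)
open import Function.Construct.Identity using (↔-id)
open import Function.Construct.Symmetry using (↔-sym)
open import Relation.Binary.Construct.Closure.ReflexiveTransitive using (Star; ε; _◅_)
open import Relation.Binary.PropositionalEquality
open import Relation.Nullary using (yes; no; _×-dec_)
open import Relation.Nullary.Decidable using (from-yes)

-- `RT` adds one branch at a time, so a vertex with many branches needs no treatment of its own:
-- merging the states of two terms is a finite table, and the ten configurations are the states that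
-- this table produces from single vertices. The price is that one rooted tree has several terms;
-- hence twins such as `V₁` and `V₂`. Minimality of D is always measured against γ(T), not γt2(T). A
-- competitor that refutes a wasteful configuration, or that covers a removed piece in a count,
-- therefore only has to dominate; partners matter only for sets that are kept. An exchange must not
-- disturb members elsewhere whose partners are unknown during the scan. Moving members towards the
-- root is safe for this reason: a member at the root of a subtree serves the rest of the tree at
-- least as well as one below it.

private variable
  A B C A′ B′ : Set
  n m k l : ℕ

-- Gluing graphs along an edge

data SplitView (n m : ℕ) : Fin (n + m) → Set where
  left  : (i : Fin n) → SplitView n m (i ↑ˡ m)
  right : (j : Fin m) → SplitView n m (n ↑ʳ j)

splitView : ∀ n m i → SplitView n m i
splitView n m i = subst (SplitView n m) (join-splitAt n m i) (view (splitAt n i))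
  where
  view : ∀ s → SplitView n m (join n m s)
  view (inj₁ a) = left a
  view (inj₂ b) = right b

==⇒≡ : {a b : Fin n} → (a == b) ≡ true → a ≡ b
==⇒≡ {a = a} {b} e with a ≟ b
... | yes p = p

==-refl : (a : Fin n) → (a == a) ≡ true
==-refl a with a ≟ a
... | yes _ = refl
... | no ¬p = ⊥-elim (¬p refl)

≢⇒== : {a b : Fin n} → a ≢ b → (a == b) ≡ false
≢⇒== {a = a} {b} a≢b with a ≟ b
... | yes p = ⊥-elim (a≢b p)
... | no _ = refl

==-cong : (f : Fin n → Fin m) → (∀ {a b} → f a ≡ f b → a ≡ b) → ∀ a b → (a == b) ≡ (f a == f b)
==-cong f inj a b with a ≟ b
... | yes refl = sym (==-refl (f a))
... | no a≢b = sym (≢⇒== (a≢b ∘ inj))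

-- On a sum type, rearranging three glued parts is a shuffle of constructors. The attachment points
-- are predicates because a vertex of one part, seen in a glued graph, becomes a predicate that is
-- false on the other part.
glue : (A → A → Bool) → (B → B → Bool) → (A → Bool) → (B → Bool) → A ⊎ B → A ⊎ B → Bool
glue G H p q (inj₁ a) (inj₁ b) = G a b
glue G H p q (inj₂ a) (inj₂ b) = H a b
glue G H p q (inj₁ a) (inj₂ b) = p a ∧ q b
glue G H p q (inj₂ a) (inj₁ b) = p b ∧ q a

==-left : (v : Fin n) (i : Fin (n + m)) → (i == (v ↑ˡ m)) ≡ [ _== v , const false ]′ (splitAt n i)
==-left {n} {m} v i with splitView n m i
... | left a rewrite splitAt-↑ˡ n a m = sym (==-cong (_↑ˡ m) (↑ˡ-injective m _ _) a v)
... | right b rewrite splitAt-↑ʳ n m b = ≢⇒== (λ e → absurd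
    (trans (sym (splitAt-↑ʳ n m b)) (trans (cong (splitAt n) e) (splitAt-↑ˡ n v m))))
  where
  absurd : {a : Fin n} {b : Fin m} → inj₂ b ≢ inj₁ a
  absurd ()

==-right : (w : Fin m) (i : Fin (n + m)) → (i == (n ↑ʳ w)) ≡ [ const false , _== w ]′ (splitAt n i)
==-right {m} {n} w i with splitView n m i
... | right a rewrite splitAt-↑ʳ n m a = sym (==-cong (n ↑ʳ_) (↑ʳ-injective n _ _) a w)
... | left b rewrite splitAt-↑ˡ n b m = ≢⇒== (λ e → absurd
    (trans (sym (splitAt-↑ˡ n b m)) (trans (cong (splitAt n) e) (splitAt-↑ʳ n m w))))
  where
  absurd : {a : Fin n} {b : Fin m} → inj₁ a ≢ inj₂ b
  absurd ()

infix 4 _≅_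
infix 0 _,≅_

record _≅_ (G : A → A → Bool) (H : B → B → Bool) : Set where
  constructor _,≅_
  field
    bij      : A ↔ B
    preserve : ∀ i j → G i j ≡ H (Inverse.to bij i) (Inverse.to bij j)

open _≅_

_⟪_⟫ : {G : A → A → Bool} {H : B → B → Bool} → G ≅ H → A → B
I ⟪ v ⟫ = Inverse.to (bij I) v

≅⇒Iso : {G : Graph n} {H : Graph m} → G ≅ H → Iso G H
≅⇒Iso I = record { bij = bij I ; preserve = preserve I }

Iso⇒≅ : {G : Graph n} {H : Graph m} → Iso G H → G ≅ H
Iso⇒≅ I = Iso.bij I ,≅ Iso.preserve I

≅-refl : {G : A → A → Bool} → G ≅ G
≅-refl = ↔-id _ ,≅ λ _ _ → refl

≅-sym : {G : A → A → Bool} {H : B → B → Bool} → G ≅ H → H ≅ G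
≅-sym {H = H} I = ↔-sym (bij I) ,≅ λ i j →
  sym (trans (preserve I (from i) (from j)) (cong₂ H (inverseˡ refl) (inverseˡ refl)))
  where open Inverse (bij I)

≅-trans : {G : A → A → Bool} {H : B → B → Bool} {K : C → C → Bool} → G ≅ H → H ≅ K → G ≅ K
≅-trans I J = bij J ↔-∘ bij I ,≅ λ i j → trans (preserve I i j) (preserve J _ _)

glue-cong : {G : A → A → Bool} {H : B → B → Bool} {p : A → Bool} {q : B → Bool}
  {G′ : A′ → A′ → Bool} {H′ : B′ → B′ → Bool} {p′ : A′ → Bool} {q′ : B′ → Bool}
  (I : G ≅ G′) (J : H ≅ H′) → (∀ a → p a ≡ p′ (I ⟪ a ⟫)) → (∀ b → q b ≡ q′ (J ⟪ b ⟫)) →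
  glue G H p q ≅ glue G′ H′ p′ q′
glue-cong {G = G} {H} {p} {q} {G′} {H′} {p′} {q′} I J ep eq = bij I ⊎-↔ bij J ,≅ pres
  where
  pres : ∀ x y → glue G H p q x y ≡ glue G′ H′ p′ q′ (Sum.map (I ⟪_⟫) (J ⟪_⟫) x) (Sum.map (I ⟪_⟫) (J ⟪_⟫) y)
  pres (inj₁ a) (inj₁ b) = preserve I a b
  pres (inj₂ a) (inj₂ b) = preserve J a b
  pres (inj₁ a) (inj₂ b) = cong₂ _∧_ (ep a) (eq b)
  pres (inj₂ a) (inj₁ b) = cong₂ _∧_ (ep b) (eq a)

attach≅glue : (G : Graph n) (H : Graph m) (v : Fin n) (h : Fin m) →
  attach G H v h ≅ glue G H (_== v) (_== h)
attach≅glue {n} G H v h = +↔⊎ ,≅ pres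
  where
  pres : ∀ i j → attach G H v h i j ≡ glue G H (_== v) (_== h) (splitAt n i) (splitAt n j)
  pres i j with splitAt n i | splitAt n j
  ... | inj₁ a | inj₁ b = refl
  ... | inj₂ a | inj₂ b = refl
  ... | inj₁ a | inj₂ b = refl
  ... | inj₂ a | inj₁ b = refl

==-≅ : {G : Graph n} {H : Graph m} (I : G ≅ H) (v a : Fin n) → (a == v) ≡ ((I ⟪ a ⟫) == (I ⟪ v ⟫))
==-≅ I v a = ==-cong (I ⟪_⟫) (λ {a} {b} e → trans (sym (inverseʳ refl)) (trans (cong from e) (inverseʳ refl))) a v
  where open Inverse (bij I)

attach-cong : {G : Graph n} {G′ : Graph k} {H : Graph m} {H′ : Graph l} (I : G ≅ G′) (J : H ≅ H′)
  {v : Fin n} {h : Fin m} {v′ : Fin k} {h′ : Fin l} → I ⟪ v ⟫ ≡ v′ → J ⟪ h ⟫ ≡ h′ →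
  attach G H v h ≅ attach G′ H′ v′ h′
attach-cong I J {v} {h} ev eh =
  ≅-trans (attach≅glue _ _ v h)
  (≅-trans (glue-cong I J (λ a → trans (==-≅ I v a) (cong ((I ⟪ a ⟫) ==_) ev)) (λ b → trans (==-≅ J h b) (cong ((J ⟪ b ⟫) ==_) eh)))
  (≅-sym (attach≅glue _ _ _ _)))

attach-cong-left : {G : Graph n} {G′ : Graph k} {H : Graph m} {H′ : Graph l} (I : G ≅ G′) (J : H ≅ H′)
  {v : Fin n} {h : Fin m} {v′ : Fin k} {h′ : Fin l} (ev : I ⟪ v ⟫ ≡ v′) (eh : J ⟪ h ⟫ ≡ h′) →
  ∀ a → attach-cong I J ev eh ⟪ a ↑ˡ m ⟫ ≡ (I ⟪ a ⟫) ↑ˡ l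
attach-cong-left {n} {m = m} I J ev eh a rewrite splitAt-↑ˡ n a m = refl

module _ (G : Graph n) (H : Graph m) (D : Graph k) (v : Fin n) (h : Fin m) (d : Fin k) where

  attach-swap : ∀ r → attach (attach G H v h) D (r ↑ˡ m) d ≅ attach (attach G D r d) H (v ↑ˡ k) h
  attach-swap r =
    ≅-trans (attach≅glue _ _ _ _)
    (≅-trans (glue-cong (attach≅glue _ _ _ _) ≅-refl (==-left r) (λ _ → refl))
    (≅-trans (mk↔ₛ′ swap swap swap-swap swap-swap ,≅ pres)
    (≅-trans (≅-sym (glue-cong (attach≅glue _ _ _ _) ≅-refl (==-left v) (λ _ → refl)))
    (≅-sym (attach≅glue _ _ _ _)))))
    where
    swap : (A ⊎ B) ⊎ C → (A ⊎ C) ⊎ B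
    swap (inj₁ (inj₁ a)) = inj₁ (inj₁ a)
    swap (inj₁ (inj₂ b)) = inj₂ b
    swap (inj₂ c) = inj₁ (inj₂ c)
    swap-swap : (x : (A ⊎ B) ⊎ C) → swap (swap x) ≡ x
    swap-swap (inj₁ (inj₁ a)) = refl
    swap-swap (inj₁ (inj₂ b)) = refl
    swap-swap (inj₂ c) = refl
    pres : ∀ x y → glue (glue G H (_== v) (_== h)) D [ _== r , const false ]′ (_== d) x y
      ≡ glue (glue G D (_== r) (_== d)) H [ _== v , const false ]′ (_== h) (swap x) (swap y)
    pres (inj₁ (inj₁ _)) (inj₁ (inj₁ _)) = refl
    pres (inj₁ (inj₁ _)) (inj₁ (inj₂ _)) = refl
    pres (inj₁ (inj₁ _)) (inj₂ _) = refl
    pres (inj₁ (inj₂ _)) (inj₁ (inj₁ _)) = refl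
    pres (inj₁ (inj₂ _)) (inj₁ (inj₂ _)) = refl
    pres (inj₁ (inj₂ _)) (inj₂ _) = refl
    pres (inj₂ _) (inj₁ (inj₁ _)) = refl
    pres (inj₂ _) (inj₁ (inj₂ _)) = refl
    pres (inj₂ _) (inj₂ _) = refl

  attach-swap-left : ∀ r a → attach-swap r ⟪ (a ↑ˡ m) ↑ˡ k ⟫ ≡ (a ↑ˡ k) ↑ˡ m
  attach-swap-left r a rewrite splitAt-↑ˡ (n + m) (a ↑ˡ m) k | splitAt-↑ˡ n a m = refl

  attach-assoc : ∀ r → attach D (attach G H v h) d (r ↑ˡ m) ≅ attach (attach D G d r) H (k ↑ʳ v) h
  attach-assoc r =
    ≅-trans (attach≅glue _ _ _ _)
    (≅-trans (glue-cong ≅-refl (attach≅glue _ _ _ _) (λ _ → refl) (==-left r))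
    (≅-trans (mk↔ₛ′ to from to-from from-to ,≅ pres)
    (≅-trans (≅-sym (glue-cong (attach≅glue _ _ _ _) ≅-refl (==-right v) (λ _ → refl)))
    (≅-sym (attach≅glue _ _ _ _)))))
    where
    to : A ⊎ (B ⊎ C) → (A ⊎ B) ⊎ C
    to (inj₁ a) = inj₁ (inj₁ a)
    to (inj₂ (inj₁ b)) = inj₁ (inj₂ b)
    to (inj₂ (inj₂ c)) = inj₂ c
    from : (A ⊎ B) ⊎ C → A ⊎ (B ⊎ C)
    from (inj₁ (inj₁ a)) = inj₁ a
    from (inj₁ (inj₂ b)) = inj₂ (inj₁ b)
    from (inj₂ c) = inj₂ (inj₂ c)
    to-from : (x : (A ⊎ B) ⊎ C) → to (from x) ≡ x
    to-from (inj₁ (inj₁ a)) = refl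
    to-from (inj₁ (inj₂ b)) = refl
    to-from (inj₂ c) = refl
    from-to : (x : A ⊎ (B ⊎ C)) → from (to x) ≡ x
    from-to (inj₁ a) = refl
    from-to (inj₂ (inj₁ b)) = refl
    from-to (inj₂ (inj₂ c)) = refl
    pres : ∀ x y → glue D (glue G H (_== v) (_== h)) (_== d) [ _== r , const false ]′ x y
      ≡ glue (glue D G (_== d) (_== r)) H [ const false , _== v ]′ (_== h) (to x) (to y)
    pres (inj₁ _) (inj₁ _) = refl
    pres (inj₁ _) (inj₂ (inj₁ _)) = refl
    pres (inj₁ _) (inj₂ (inj₂ _)) = ∧-zeroʳ _
    pres (inj₂ (inj₁ _)) (inj₁ _) = refl
    pres (inj₂ (inj₁ _)) (inj₂ (inj₁ _)) = refl
    pres (inj₂ (inj₁ _)) (inj₂ (inj₂ _)) = refl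
    pres (inj₂ (inj₂ _)) (inj₁ _) = ∧-zeroʳ _
    pres (inj₂ (inj₂ _)) (inj₂ (inj₁ _)) = refl
    pres (inj₂ (inj₂ _)) (inj₂ (inj₂ _)) = refl

  attach-assoc-left : ∀ r a → attach-assoc r ⟪ a ↑ˡ (n + m) ⟫ ≡ (a ↑ˡ n) ↑ˡ m
  attach-assoc-left r a rewrite splitAt-↑ˡ k a (n + m) = refl

-- Rooted trees and contexts

-- t ▹ c hangs c below the root of t, so a subterm may carry only some of the branches at its root.
infixl 5 _▹_

data RT : Set where
  •   : RT
  _▹_ : RT → RT → RT

size : RT → ℕ
size • = 1
size (t ▹ c) = size t + size c

root : (t : RT) → Fin (size t)
root • = zero
root (t ▹ c) = root t ↑ˡ size c

⟦_⟧ : (t : RT) → Graph (size t)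
⟦ • ⟧ = K1
⟦ t ▹ c ⟧ = attach ⟦ t ⟧ ⟦ c ⟧ (root t) (root c)

private variable
  s t c : RT

infixl 6 _◃▹_ _▹◃_

-- Read from the hole outwards. In `κ ◃▹ c` the root of the hole stays the root of the enclosing
-- subtree and carries the further branch `c`; in `κ ▹◃ t` the hole itself is a branch at the root
-- of `t`.
data Ctx : Set where
  top : Ctx
  _◃▹_ : Ctx → RT → Ctx
  _▹◃_ : Ctx → RT → Ctx

private variable
  κ : Ctx

plug : Ctx → RT → RT
plug top s = s
plug (κ ◃▹ c) s = plug κ (s ▹ c)
plug (κ ▹◃ t) s = plug κ (t ▹ s)

embed : (κ : Ctx) (s : RT) → Fin (size s) → Fin (size (plug κ s))
embed top s i = i
embed (κ ◃▹ c) s i = embed κ (s ▹ c) (i ↑ˡ size c)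
embed (κ ▹◃ t) s i = embed κ (t ▹ s) (size t ↑ʳ i)

-- By induction on the context: `attach-swap` deals with a further branch at the root of the hole,
-- `attach-assoc` with a step to the parent. The isomorphism has to respect the root because the
-- next layer of the context is glued there.
plug-attach : ∀ κ {s s′ m} {H : Graph m} {v : Fin (size s′)} {h : Fin m}
  (I : ⟦ s ⟧ ≅ attach ⟦ s′ ⟧ H v h) → I ⟪ root s ⟫ ≡ root s′ ↑ˡ m →
  ⟦ plug κ s ⟧ ≅ attach ⟦ plug κ s′ ⟧ H (embed κ s′ v) h
plug-attach top I _ = I
plug-attach (κ ◃▹ c) {s} {s′} {H = H} {v} {h} I Ir = plug-attach κ
  (≅-trans (attach-cong I ≅-refl Ir refl) (attach-swap ⟦ s′ ⟧ H ⟦ c ⟧ v h (root c) (root s′)))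
  (trans (cong (attach-swap ⟦ s′ ⟧ H ⟦ c ⟧ v h (root c) (root s′) ⟪_⟫)
               (trans (attach-cong-left I (≅-refl {G = ⟦ c ⟧}) {h = root c} Ir refl (root s)) (cong (_↑ˡ size c) Ir)))
         (attach-swap-left ⟦ s′ ⟧ H ⟦ c ⟧ v h (root c) (root s′) (root s′)))
plug-attach (κ ▹◃ t) {s} {s′} {H = H} {v} {h} I Ir = plug-attach κ
  (≅-trans (attach-cong ≅-refl I refl Ir) (attach-assoc ⟦ s′ ⟧ H ⟦ t ⟧ v h (root t) (root s′)))
  (trans (cong (attach-assoc ⟦ s′ ⟧ H ⟦ t ⟧ v h (root t) (root s′) ⟪_⟫)
               (attach-cong-left (≅-refl {G = ⟦ t ⟧}) I {v = root t} refl Ir (root t)))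
         (attach-assoc-left ⟦ s′ ⟧ H ⟦ t ⟧ v h (root t) (root s′) (root t)))

-- Turns a cut inside a term into an attachment to all of the remaining tree, the form that the
-- operations have.
plug-▹ : ∀ κ s c → ⟦ plug κ (s ▹ c) ⟧ ≅ attach ⟦ plug κ s ⟧ ⟦ c ⟧ (embed κ s (root s)) (root c)
plug-▹ κ s c = plug-attach κ ≅-refl refl

data Focus : (t : RT) → Fin (size t) → Set where
  focus : ∀ κ s → Focus (plug κ s) (embed κ s (root s))

-- Descends to the single `•` of the vertex. This is how `attach-leaf` can hang a new leaf at any
-- vertex of a term.
focus-vertex : ∀ κ s i → Focus (plug κ s) (embed κ s i)
focus-vertex κ • zero = focus κ •
focus-vertex κ (s ▹ c) i with splitView (size s) (size c) i
... | left a = focus-vertex (κ ◃▹ c) s a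
... | right b = focus-vertex (κ ▹◃ s) c b

attach-leaf : ∀ t v → ∃[ t′ ] (attach ⟦ t ⟧ K1 v zero ≅ ⟦ t′ ⟧)
attach-leaf t v with focus-vertex top t v
... | focus κ s = plug κ (s ▹ •) , ≅-sym (plug-▹ κ s •)

-- Every tree is the graph of a rooted tree, by removing leaves

indicator : Bool → ℕ
indicator b = if b then 1 else 0

card≡sum : ∀ {n} (f : Fin n → Bool) → ∣ tabulate f ∣ ≡ sum (indicator ∘ f)
card≡sum {zero} f = refl
card≡sum {suc n} f with f zero
... | true = cong suc (card≡sum (f ∘ suc))
... | false = card≡sum (f ∘ suc)

vec-sum≡sum : ∀ {n} (f : Fin n → ℕ) → Vec.sum (tabulate f) ≡ sum f
vec-sum≡sum {zero} f = refl
vec-sum≡sum {suc n} f = cong (f zero +_) (vec-sum≡sum (f ∘ suc))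

sum≡0 : ∀ {n} (f : Fin n → ℕ) → sum f ≡ 0 → ∀ i → f i ≡ 0
sum≡0 f e zero = m+n≡0⇒m≡0 (f zero) e
sum≡0 f e (suc i) = sum≡0 (f ∘ suc) (m+n≡0⇒n≡0 (f zero) e) i

sum-lower : ∀ {n} k (f : Fin n → ℕ) → (∀ i → k ≤ f i) → n * k ≤ sum f
sum-lower {zero} k f h = z≤n
sum-lower {suc n} k f h = +-mono-≤ (h zero) (sum-lower k (f ∘ suc) (h ∘ suc))

sum-positive : ∀ {n} (f : Fin n → ℕ) i → f i ≤ sum f
sum-positive f zero = m≤m+n (f zero) _
sum-positive f (suc i) = ≤-trans (sum-positive (f ∘ suc) i) (m≤n+m _ (f zero))

indicator≡0 : ∀ {b} → indicator b ≡ 0 → b ≡ false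
indicator≡0 {false} e = refl

degree≡sum : ∀ {n} (T : Graph n) v → degree T v ≡ sum (indicator ∘ T v)
degree≡sum T v = card≡sum (T v)

-- The tree axioms without the bound on the number of vertices, so that leaves can be removed down to a single vertex.
record Tree₁ {n : ℕ} (T : Graph (suc n)) : Set where
  field
    symmetric   : ∀ u v → T u v ≡ T v u
    irreflexive : ∀ v → T v v ≡ false
    connected   : Connected T
    edgeCount   : sum (λ v → sum (indicator ∘ T v)) ≡ 2 * n

module _ {n : ℕ} {T : Graph (suc (suc n))} (tree : Tree₁ T) where
  open Tree₁ tree

  neighbour : ∀ v → ∃[ w ] Adj T v w
  neighbour v with punchIn v zero | punchInᵢ≢i v zero
  ... | w | w≢v with connected v w
  ...   | ε = ⊥-elim (w≢v refl)
  ...   | e ◅ _ = _ , e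

  positive-degree : ∀ v → 1 ≤ sum (indicator ∘ T v)
  positive-degree v with neighbour v
  ... | w , e = ≤-trans (≤-reflexive (sym (cong indicator e))) (sum-positive (indicator ∘ T v) w)

  -- If all degrees were at least 2, the degree sum would exceed the one prescribed by the edge
  -- count by at least 2; connectedness excludes degree 0.
  leaf-exists : ∃[ u ] sum (indicator ∘ T u) ≡ 1
  leaf-exists with any? (λ u → sum (indicator ∘ T u) ≤? 1)
  ... | yes (u , d≤1) = u , ≤-antisym d≤1 (positive-degree u)
  ... | no none = ⊥-elim (<⇒≱ (*-monoʳ-< 2 (n<1+n (suc n))) (≤-trans (≤-reflexive (*-comm 2 (suc (suc n)))) (≤-trans
          (sum-lower 2 _ (λ i → ≰⇒> (λ d≤1 → none (i , d≤1)))) (≤-reflexive edgeCount))))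

  module _ {u v : Fin (suc (suc n))} (deg-u : sum (indicator ∘ T u) ≡ 1) (uv : Adj T u v) where

    only-neighbour : ∀ {w} → Adj T u w → w ≡ v
    only-neighbour {w} uw with w ≟ v
    ... | yes p = p
    ... | no w≢v = ⊥-elim (contra (trans (sym uw) (trans (cong (T u) (sym (punchIn-punchOut (w≢v ∘ sym))))
                     (indicator≡0 (sum≡0 (indicator ∘ T u ∘ punchIn v) rest (punchOut (w≢v ∘ sym)))))))
      where
      contra : true ≢ false
      contra ()
      rest : sum (indicator ∘ T u ∘ punchIn v) ≡ 0
      rest = suc-injective (trans (cong (λ b → indicator b + sum (indicator ∘ T u ∘ punchIn v)) (sym uv))
                           (trans (sym (sum-remove {i = v} (indicator ∘ T u))) deg-u))

    removeLeaf : Graph (suc n)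
    removeLeaf i j = T (punchIn u i) (punchIn u j)

    u≢v : u ≢ v
    u≢v refl with trans (sym uv) (irreflexive u)
    ... | ()

    attachment : Fin (suc n)
    attachment = punchOut u≢v

    punchIn-attachment : punchIn u attachment ≡ v
    punchIn-attachment = punchIn-punchOut u≢v

    -- The invariant for clearing a walk of its visits to the leaf. A walk that starts at the leaf
    -- is traded for one that starts at its only neighbour, so a visit in the middle is cut out as a
    -- detour.
    data Avoid (x : Fin (suc (suc n))) (b : Fin (suc n)) : Set where
      at-leaf : x ≡ u → Star (Adj removeLeaf) attachment b → Avoid x b
      beside  : ∀ a → x ≡ punchIn u a → Star (Adj removeLeaf) a b → Avoid x b

    avoid : ∀ {x y} b → y ≡ punchIn u b → Star (Adj T) x y → Avoid x b
    avoid b refl ε = beside b refl ε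
    avoid {x} b e (_◅_ {j = z} xz walk) with avoid b e walk
    ... | at-leaf refl w = beside attachment
          (trans (only-neighbour (trans (symmetric u x) xz)) (sym punchIn-attachment)) w
    ... | beside a refl w with u ≟ x
    ...   | yes refl = at-leaf refl (subst (λ q → Star (Adj removeLeaf) q b)
              (punchIn-injective u _ _ (trans (only-neighbour xz) (sym punchIn-attachment))) w)
    ...   | no u≢x = beside (punchOut u≢x) (sym (punchIn-punchOut u≢x))
              (trans (cong (λ q → T q (punchIn u a)) (punchIn-punchOut u≢x)) xz ◅ w)

    removeLeaf-tree : Tree₁ removeLeaf
    removeLeaf-tree = record
      { symmetric = λ _ _ → symmetric _ _
      ; irreflexive = λ _ → irreflexive _
      ; connected = conn
      -- The row and the column of the leaf contribute 1 each, so the degree sum falls by 2.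
      ; edgeCount = suc-injective (suc-injective (trans (sym total) (trans edgeCount (*-suc 2 n))))
      }
      where
      conn : Connected removeLeaf
      conn a b with avoid b refl (connected (punchIn u a) (punchIn u b))
      ... | at-leaf e _ = ⊥-elim (punchInᵢ≢i u a e)
      ... | beside a′ e w rewrite punchIn-injective u _ _ e = w
      to-u : sum (λ i → indicator (T (punchIn u i) u)) ≡ 1
      to-u = trans (sum-cong-≗ (λ i → cong indicator (symmetric (punchIn u i) u)))
             (trans (cong (λ b → indicator b + sum (indicator ∘ T u ∘ punchIn u)) (sym (irreflexive u)))
             (trans (sym (sum-remove {i = u} (indicator ∘ T u))) deg-u))
      total : sum (λ x → sum (indicator ∘ T x)) ≡ suc (suc (sum (λ i → sum (indicator ∘ removeLeaf i))))
      total = trans (sum-remove {i = u} (λ x → sum (indicator ∘ T x)))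
        (cong₂ _+_ deg-u (trans (sum-cong-≗ (λ i → sum-remove {i = u} (indicator ∘ T (punchIn u i))))
          (trans (∑-distrib-+ (λ i → indicator (T (punchIn u i) u)) (λ i → sum (indicator ∘ removeLeaf i)))
                 (cong (_+ sum (λ i → sum (indicator ∘ removeLeaf i))) to-u))))

    attach-removed : attach removeLeaf K1 attachment zero ≅ T
    attach-removed = ≅-trans (attach≅glue _ _ _ _) (mk↔ₛ′ to from to-from from-to ,≅ pres)
      where
      to : Fin (suc n) ⊎ Fin 1 → Fin (suc (suc n))
      to (inj₁ a) = punchIn u a
      to (inj₂ _) = u
      from : Fin (suc (suc n)) → Fin (suc n) ⊎ Fin 1
      from x with u ≟ x
      ... | yes _ = inj₂ zero
      ... | no u≢x = inj₁ (punchOut u≢x)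
      to-from : ∀ x → to (from x) ≡ x
      to-from x with u ≟ x
      ... | yes e = e
      ... | no u≢x = punchIn-punchOut u≢x
      from-to : ∀ x → from (to x) ≡ x
      from-to (inj₁ a) with u ≟ punchIn u a
      ... | yes e = ⊥-elim (punchInᵢ≢i u a (sym e))
      ... | no u≢x = cong inj₁ (punchOut-punchIn u)
      from-to (inj₂ zero) with u ≟ u
      ... | yes _ = refl
      ... | no u≢u = ⊥-elim (u≢u refl)
      edge : ∀ a → (a == attachment) ≡ T u (punchIn u a)
      edge a with a ≟ attachment
      ... | yes refl = sym (trans (cong (T u) punchIn-attachment) uv)
      ... | no a≢ with T u (punchIn u a) in q
      ...   | false = refl
      ...   | true = ⊥-elim (a≢ (punchIn-injective u _ _ (trans (only-neighbour q) (sym punchIn-attachment))))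
      pres : ∀ x y → glue removeLeaf K1 (_== attachment) (_== zero) x y ≡ T (to x) (to y)
      pres (inj₁ a) (inj₁ b) = refl
      pres (inj₁ a) (inj₂ zero) = trans (∧-identityʳ _) (trans (edge a) (symmetric u _))
      pres (inj₂ zero) (inj₁ b) = trans (∧-identityʳ _) (edge b)
      pres (inj₂ zero) (inj₂ zero) = sym (irreflexive u)

rooted₁ : ∀ {n} {T : Graph (suc n)} → Tree₁ T → ∃[ t ] (⟦ t ⟧ ≅ T)
rooted₁ {zero} tree = • , (≅-sym (mk↔ₛ′ id id (λ _ → refl) (λ _ → refl) ,≅ λ { zero zero → Tree₁.irreflexive tree zero }))
rooted₁ {suc n} {T} tree with leaf-exists tree
... | u , deg-u with neighbour tree u
...   | v , uv with rooted₁ (removeLeaf-tree tree deg-u uv)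
...     | t , I with attach-leaf t (≅-sym I ⟪ attachment tree deg-u uv ⟫)
...       | t′ , J = t′ , ≅-trans (≅-sym J) (≅-trans
            (attach-cong I ≅-refl (Inverse.inverseˡ (_≅_.bij I) refl) refl) (attach-removed tree deg-u uv))

rooted : ∀ {n} {T : Graph n} → IsTree T → ∃[ t ] (⟦ t ⟧ ≅ T)
rooted {zero} tree with IsTree.atLeastTwo tree
... | ()
rooted {suc n} {T} tree = rooted₁ (record
  { symmetric = symmetric ; irreflexive = irreflexive ; connected = connected
  ; edgeCount = trans (sum-cong-≗ (λ v → sym (degree≡sum T v))) (trans (sym (vec-sum≡sum (degree T))) edgeCount) })
  where open IsTree tree

∨-true : ∀ {b c} → b ∨ c ≡ true → b ≡ true ⊎ c ≡ true
∨-true {true} _ = inj₁ refl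
∨-true {false} e = inj₂ e

∨-introˡ : ∀ {b c} → b ≡ true → b ∨ c ≡ true
∨-introˡ refl = refl

∨-introʳ : ∀ {b c} → c ≡ true → b ∨ c ≡ true
∨-introʳ {b} refl = ∨-zeroʳ b

∧-true : ∀ {b c} → b ∧ c ≡ true → b ≡ true × c ≡ true
∧-true {true} e = refl , e

∧-intro : ∀ {b c} → b ≡ true → c ≡ true → b ∧ c ≡ true
∧-intro refl e = e

true≢false : {A : Set} {b : Bool} → b ≡ true → b ≡ false → A
true≢false refl ()

-- Marked trees

-- Domination and semitotality of a set given by its membership function f, in a graph
-- whose vertex v also sees outside members: e₁ says that there is one at distance 1 from v, e₂ at distance 2.
DominatesFrom : Graph n → Fin n → Bool → (Fin n → Bool) → Set
DominatesFrom G v e₁ f = ∀ w → f w ≡ true ⊎ (∃[ u ] (f u ≡ true × Adj G u w)) ⊎ (w ≡ v × e₁ ≡ true)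

PairedFrom : Graph n → Fin n → Bool → Bool → (Fin n → Bool) → Set
PairedFrom G v e₁ e₂ f = ∀ u → f u ≡ true →
  (∃[ w ] (f w ≡ true × u ≢ w × Within2 G u w)) ⊎ (u ≡ v × e₁ ∨ e₂ ≡ true) ⊎ (Adj G u v × e₁ ≡ true)

HasNeighbour : Graph n → Fin n → (Fin n → Bool) → Set
HasNeighbour G v f = ∃[ w ] (f w ≡ true × Adj G v w)

module _ {n m} (G : Graph n) (H : Graph m) (v : Fin n) (h : Fin m) where

  private
    GH = attach G H v h

  attach-ll : ∀ a b → GH (a ↑ˡ m) (b ↑ˡ m) ≡ G a b
  attach-ll a b rewrite splitAt-↑ˡ n a m | splitAt-↑ˡ n b m = refl

  attach-rr : ∀ a b → GH (n ↑ʳ a) (n ↑ʳ b) ≡ H a b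
  attach-rr a b rewrite splitAt-↑ʳ n m a | splitAt-↑ʳ n m b = refl

  attach-lr : ∀ a b → GH (a ↑ˡ m) (n ↑ʳ b) ≡ (a == v) ∧ (b == h)
  attach-lr a b rewrite splitAt-↑ˡ n a m | splitAt-↑ʳ n m b = refl

  attach-rl : ∀ b a → GH (n ↑ʳ b) (a ↑ˡ m) ≡ (a == v) ∧ (b == h)
  attach-rl b a rewrite splitAt-↑ˡ n a m | splitAt-↑ʳ n m b = refl

  bridge-lr : Adj GH (v ↑ˡ m) (n ↑ʳ h)
  bridge-lr = trans (attach-lr v h) (∧-intro (==-refl v) (==-refl h))

  bridge-rl : Adj GH (n ↑ʳ h) (v ↑ˡ m)
  bridge-rl = trans (attach-rl h v) (∧-intro (==-refl v) (==-refl h))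

  lr-bridge : ∀ {a b} → Adj GH (a ↑ˡ m) (n ↑ʳ b) → a ≡ v × b ≡ h
  lr-bridge {a} {b} e with ∧-true (trans (sym (attach-lr a b)) e)
  ... | p , q = ==⇒≡ p , ==⇒≡ q

  rl-bridge : ∀ {a b} → Adj GH (n ↑ʳ b) (a ↑ˡ m) → a ≡ v × b ≡ h
  rl-bridge {a} {b} e with ∧-true (trans (sym (attach-rl b a)) e)
  ... | p , q = ==⇒≡ p , ==⇒≡ q

  ll⁺ : ∀ {a b} → Adj G a b → Adj GH (a ↑ˡ m) (b ↑ˡ m)
  ll⁺ = trans (attach-ll _ _)

  ll⁻ : ∀ {a b} → Adj GH (a ↑ˡ m) (b ↑ˡ m) → Adj G a b
  ll⁻ = trans (sym (attach-ll _ _))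

  rr⁺ : ∀ {a b} → Adj H a b → Adj GH (n ↑ʳ a) (n ↑ʳ b)
  rr⁺ = trans (attach-rr _ _)

  rr⁻ : ∀ {a b} → Adj GH (n ↑ʳ a) (n ↑ʳ b) → Adj H a b
  rr⁻ = trans (sym (attach-rr _ _))

  l≢r : ∀ {a : Fin n} {b : Fin m} → a ↑ˡ m ≢ n ↑ʳ b
  l≢r {a} {b} e with trans (sym (splitAt-↑ˡ n a m)) (trans (cong (splitAt n) e) (splitAt-↑ʳ n m b))
  ... | ()

  module _ (f : Fin (n + m) → Bool) (f₁ : Fin n → Bool) (f₂ : Fin m → Bool)
           (fl : ∀ a → f (a ↑ˡ m) ≡ f₁ a) (fr : ∀ b → f (n ↑ʳ b) ≡ f₂ b) where

    private
      fl⁺ : ∀ {a} → f₁ a ≡ true → f (a ↑ˡ m) ≡ true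
      fl⁺ = trans (fl _)
      fl⁻ : ∀ {a} → f (a ↑ˡ m) ≡ true → f₁ a ≡ true
      fl⁻ = trans (sym (fl _))
      fr⁺ : ∀ {b} → f₂ b ≡ true → f (n ↑ʳ b) ≡ true
      fr⁺ = trans (fr _)
      fr⁻ : ∀ {b} → f (n ↑ʳ b) ≡ true → f₂ b ≡ true
      fr⁻ = trans (sym (fr _))

    module _ (e₁ : Bool) where

      dominatesˡ : DominatesFrom GH (v ↑ˡ m) e₁ f → DominatesFrom G v (e₁ ∨ f₂ h) f₁
      dominatesˡ D w with D (w ↑ˡ m)
      ... | inj₁ p = inj₁ (fl⁻ p)
      ... | inj₂ (inj₂ (e , p)) = inj₂ (inj₂ (↑ˡ-inj e , ∨-introˡ p))
        where
        ↑ˡ-inj = ↑ˡ-injective m w v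
      ... | inj₂ (inj₁ (u , fu , uw)) with splitView n m u
      ...   | left a = inj₂ (inj₁ (a , fl⁻ fu , ll⁻ uw))
      ...   | right b with rl-bridge uw
      ...     | refl , refl = inj₂ (inj₂ (refl , ∨-introʳ (fr⁻ fu)))

      dominatesʳ : DominatesFrom GH (v ↑ˡ m) e₁ f → DominatesFrom H h (f₁ v) f₂
      dominatesʳ D w with D (n ↑ʳ w)
      ... | inj₁ p = inj₁ (fr⁻ p)
      ... | inj₂ (inj₂ (e , p)) = ⊥-elim (l≢r (sym e))
      ... | inj₂ (inj₁ (u , fu , uw)) with splitView n m u
      ...   | right b = inj₂ (inj₁ (b , fr⁻ fu , rr⁻ uw))
      ...   | left a with lr-bridge uw
      ...     | refl , refl = inj₂ (inj₂ (refl , fl⁻ fu))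

      dominates : DominatesFrom G v (e₁ ∨ f₂ h) f₁ → DominatesFrom H h (f₁ v) f₂ → DominatesFrom GH (v ↑ˡ m) e₁ f
      dominates D E w with splitView n m w
      dominates D E _ | left a with D a
      ... | inj₁ p = inj₁ (fl⁺ p)
      ... | inj₂ (inj₁ (u , fu , uw)) = inj₂ (inj₁ (u ↑ˡ m , fl⁺ fu , ll⁺ uw))
      ... | inj₂ (inj₂ (refl , p)) with ∨-true {e₁} p
      ...   | inj₁ q = inj₂ (inj₂ (refl , q))
      ...   | inj₂ q = inj₂ (inj₁ (n ↑ʳ h , fr⁺ q , bridge-rl))
      dominates D E _ | right b with E b
      ... | inj₁ p = inj₁ (fr⁺ p)
      ... | inj₂ (inj₁ (u , fu , uw)) = inj₂ (inj₁ (n ↑ʳ u , fr⁺ fu , rr⁺ uw))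
      ... | inj₂ (inj₂ (refl , p)) = inj₂ (inj₁ (v ↑ˡ m , fl⁺ p , bridge-lr))

      module _ (e₂ xG xH : Bool) (XG : xG ≡ true ⇔ HasNeighbour G v f₁) (XH : xH ≡ true ⇔ HasNeighbour H h f₂) where

        -- Across the bridge, `v` sees `h` at distance 1 and the neighbours of `h` at distance 2.
        pairedˡ : PairedFrom GH (v ↑ˡ m) e₁ e₂ f → PairedFrom G v (e₁ ∨ f₂ h) (e₂ ∨ xH) f₁
        pairedˡ P u fu with P (u ↑ˡ m) (fl⁺ fu)
        ... | inj₂ (inj₁ (e , p)) = inj₂ (inj₁ (↑ˡ-injective m u v e , sum-or (∨-true {e₁} p)))
          where
          sum-or : e₁ ≡ true ⊎ e₂ ≡ true → (e₁ ∨ f₂ h) ∨ (e₂ ∨ xH) ≡ true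
          sum-or (inj₁ refl) = refl
          sum-or (inj₂ refl) = ∨-zeroʳ (e₁ ∨ f₂ h)
        ... | inj₂ (inj₂ (uv , p)) = inj₂ (inj₂ (ll⁻ uv , ∨-introˡ p))
        ... | inj₁ (w , fw , u≢w , near) with splitView n m w
        pairedˡ P u fu | inj₁ (_ , fw , u≢w , inj₁ uw) | left w = inj₁ (w , fl⁻ fw , u≢w ∘ cong (_↑ˡ m) , inj₁ (ll⁻ uw))
        pairedˡ P u fu | inj₁ (_ , fw , u≢w , inj₂ (x , ux , xw)) | left w with splitView n m x
        ... | left y = inj₁ (w , fl⁻ fw , u≢w ∘ cong (_↑ˡ m) , inj₂ (y , ll⁻ ux , ll⁻ xw))
        -- A path of length 2 that leaves the left part and comes back uses the bridge twice, so its
        -- ends coincide.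
        ... | right y with lr-bridge ux | rl-bridge xw
        ...   | refl , _ | refl , _ = ⊥-elim (u≢w refl)
        pairedˡ P u fu | inj₁ (_ , fw , u≢w , inj₁ uw) | right w with lr-bridge uw
        ... | refl , refl = inj₂ (inj₁ (refl , ∨-introˡ (∨-introʳ {e₁} (fr⁻ fw))))
        pairedˡ P u fu | inj₁ (_ , fw , u≢w , inj₂ (x , ux , xw)) | right w with splitView n m x
        ... | left y with lr-bridge xw
        ...   | refl , refl = inj₂ (inj₂ (ll⁻ ux , ∨-introʳ {e₁} (fr⁻ fw)))
        pairedˡ P u fu | inj₁ (_ , fw , u≢w , inj₂ (x , ux , xw)) | right w | right y with lr-bridge ux
        ...   | refl , refl = inj₂ (inj₁ (refl , ∨-introʳ {e₁ ∨ f₂ h} (∨-introʳ {e₂} (Equivalence.from XH (w , fr⁻ fw , rr⁻ xw)))))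

        -- From `h`, the neighbours of `v` and an outside member next to `v` are at distance 2.
        -- Outside members at distance 2 from `v` are too far away, so `e₂` disappears.
        pairedʳ : PairedFrom GH (v ↑ˡ m) e₁ e₂ f → PairedFrom H h (f₁ v) (xG ∨ e₁) f₂
        pairedʳ P u fu with P (n ↑ʳ u) (fr⁺ fu)
        ... | inj₂ (inj₁ (e , p)) = ⊥-elim (l≢r (sym e))
        ... | inj₂ (inj₂ (uv , p)) with rl-bridge uv
        ...   | _ , refl = inj₂ (inj₁ (refl , ∨-introʳ {f₁ v} (∨-introʳ {xG} p)))
        pairedʳ P u fu | inj₁ (w , fw , u≢w , near) with splitView n m w
        pairedʳ P u fu | inj₁ (_ , fw , u≢w , inj₁ uw) | right w = inj₁ (w , fr⁻ fw , u≢w ∘ cong (n ↑ʳ_) , inj₁ (rr⁻ uw))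
        pairedʳ P u fu | inj₁ (_ , fw , u≢w , inj₂ (x , ux , xw)) | right w with splitView n m x
        ... | right y = inj₁ (w , fr⁻ fw , u≢w ∘ cong (n ↑ʳ_) , inj₂ (y , rr⁻ ux , rr⁻ xw))
        ... | left y with rl-bridge ux | lr-bridge xw
        ...   | _ , refl | _ , refl = ⊥-elim (u≢w refl)
        pairedʳ P u fu | inj₁ (_ , fw , u≢w , inj₁ uw) | left w with rl-bridge uw
        ... | refl , refl = inj₂ (inj₁ (refl , ∨-introˡ (fl⁻ fw)))
        pairedʳ P u fu | inj₁ (_ , fw , u≢w , inj₂ (x , ux , xw)) | left w with splitView n m x
        ... | right y with rl-bridge xw
        ...   | refl , refl = inj₂ (inj₂ (rr⁻ ux , fl⁻ fw))
        pairedʳ P u fu | inj₁ (_ , fw , u≢w , inj₂ (x , ux , xw)) | left w | left y with rl-bridge ux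
        ...   | refl , refl = inj₂ (inj₁ (refl , ∨-introʳ {f₁ v} (∨-introˡ (Equivalence.from XG (w , fl⁻ fw , ll⁻ xw)))))

        paired : PairedFrom G v (e₁ ∨ f₂ h) (e₂ ∨ xH) f₁ → PairedFrom H h (f₁ v) (xG ∨ e₁) f₂ → PairedFrom GH (v ↑ˡ m) e₁ e₂ f
        paired P Q w fw with splitView n m w
        paired P Q _ fw | left a with P a (fl⁻ fw)
        ... | inj₁ (w , fw′ , a≢w , near) = inj₁ (w ↑ˡ m , fl⁺ fw′ , a≢w ∘ ↑ˡ-injective m a w , up near)
          where
          up : Within2 G a w → Within2 GH (a ↑ˡ m) (w ↑ˡ m)
          up (inj₁ e) = inj₁ (ll⁺ e)
          up (inj₂ (x , ax , xw)) = inj₂ (x ↑ˡ m , ll⁺ ax , ll⁺ xw)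
        ... | inj₂ (inj₂ (av , p)) with ∨-true {e₁} p
        ...   | inj₁ q = inj₂ (inj₂ (ll⁺ av , q))
        ...   | inj₂ q = inj₁ (n ↑ʳ h , fr⁺ q , l≢r , inj₂ (v ↑ˡ m , ll⁺ av , bridge-lr))
        paired P Q _ fw | left a | inj₂ (inj₁ (refl , p)) with ∨-true {e₁ ∨ f₂ h} p
        ... | inj₁ q with ∨-true {e₁} q
        ...   | inj₁ s = inj₂ (inj₁ (refl , ∨-introˡ s))
        ...   | inj₂ s = inj₁ (n ↑ʳ h , fr⁺ s , l≢r , inj₁ bridge-lr)
        paired P Q _ fw | left a | inj₂ (inj₁ (refl , p)) | inj₂ q with ∨-true {e₂} q
        ...   | inj₁ s = inj₂ (inj₁ (refl , ∨-introʳ {e₁} s))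
        ...   | inj₂ s with Equivalence.to XH s
        ...     | w , fw′ , hw = inj₁ (n ↑ʳ w , fr⁺ fw′ , l≢r , inj₂ (n ↑ʳ h , bridge-lr , rr⁺ hw))
        paired P Q _ fw | right b with Q b (fr⁻ fw)
        ... | inj₁ (w , fw′ , b≢w , near) = inj₁ (n ↑ʳ w , fr⁺ fw′ , b≢w ∘ ↑ʳ-injective n b w , up near)
          where
          up : Within2 H b w → Within2 GH (n ↑ʳ b) (n ↑ʳ w)
          up (inj₁ e) = inj₁ (rr⁺ e)
          up (inj₂ (x , ax , xw)) = inj₂ (n ↑ʳ x , rr⁺ ax , rr⁺ xw)
        ... | inj₂ (inj₂ (bh , p)) = inj₁ (v ↑ˡ m , fl⁺ p , l≢r ∘ sym , inj₂ (n ↑ʳ h , rr⁺ bh , bridge-rl))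
        ... | inj₂ (inj₁ (refl , p)) with ∨-true {f₁ v} p
        ...   | inj₁ q = inj₁ (v ↑ˡ m , fl⁺ q , l≢r ∘ sym , inj₁ bridge-rl)
        ...   | inj₂ q with ∨-true {xG} q
        ...     | inj₂ s = inj₂ (inj₂ (bridge-rl , s))
        ...     | inj₁ s with Equivalence.to XG s
        ...       | w , fw′ , vw = inj₁ (w ↑ˡ m , fl⁺ fw′ , l≢r ∘ sym , inj₂ (v ↑ˡ m , bridge-rl , ll⁺ vw))

    hasNeighbour : ∀ {xG} → xG ≡ true ⇔ HasNeighbour G v f₁ → xG ∨ f₂ h ≡ true ⇔ HasNeighbour GH (v ↑ˡ m) f
    hasNeighbour {xG} XG = mk⇔ there back
      where
      there : xG ∨ f₂ h ≡ true → HasNeighbour GH (v ↑ˡ m) f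
      there p with ∨-true {xG} p
      ... | inj₂ q = n ↑ʳ h , fr⁺ q , bridge-lr
      ... | inj₁ q with Equivalence.to XG q
      ...   | w , fw , vw = w ↑ˡ m , fl⁺ fw , ll⁺ vw
      back : HasNeighbour GH (v ↑ˡ m) f → xG ∨ f₂ h ≡ true
      back (w , fw , vw) with splitView n m w
      ... | left a = ∨-introˡ (Equivalence.from XG (a , fl⁻ fw , ll⁻ vw))
      ... | right b with lr-bridge vw
      ...   | _ , refl = ∨-introʳ {xG} (fr⁻ fw)

data Mk : RT → Set where
  ⟨_⟩ : Bool → Mk •
  _▹_ : ∀ {t c} → Mk t → Mk c → Mk (t ▹ c)

rootIn : ∀ {t} → Mk t → Bool
rootIn ⟨ b ⟩ = b
rootIn (t ▹ c) = rootIn t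

childIn : ∀ {t} → Mk t → Bool
childIn ⟨ b ⟩ = false
childIn (t ▹ c) = childIn t ∨ rootIn c

#_ : ∀ {t} → Mk t → ℕ
# ⟨ b ⟩ = indicator b
# (t ▹ c) = # t + # c

-- dom and valid decide domination and semitotal domination; e₁ and e₂ say that there is a member outside the tree at
-- distance 1, respectively 2, from its root.
dom : ∀ {t} → Mk t → Bool → Bool
dom ⟨ b ⟩ e₁ = b ∨ e₁
dom (t ▹ c) e₁ = dom t (e₁ ∨ rootIn c) ∧ dom c (rootIn t)

valid : ∀ {t} → Mk t → Bool → Bool → Bool
valid ⟨ b ⟩ e₁ e₂ = (b ∨ e₁) ∧ (not b ∨ e₁ ∨ e₂)
valid (t ▹ c) e₁ e₂ = valid t (e₁ ∨ rootIn c) (e₂ ∨ childIn c) ∧ valid c (rootIn t) (childIn t ∨ e₁)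

marks : ∀ {t} → Mk t → Subset (size t)
marks ⟨ b ⟩ = b ∷ []
marks (t ▹ c) = marks t ++ marks c

member : ∀ {t} → Mk t → Fin (size t) → Bool
member m = lookup (marks m)

rootIn-member : ∀ {t} (m : Mk t) → member m (root t) ≡ rootIn m
rootIn-member ⟨ b ⟩ = refl
rootIn-member (_▹_ {t} {c} p q) = trans (lookup-++ˡ (marks p) (marks q) (root t)) (rootIn-member p)

module Parts {t c} (p : Mk t) (q : Mk c) where
  fl : ∀ a → member (p ▹ q) (a ↑ˡ size c) ≡ member p a
  fl = lookup-++ˡ (marks p) (marks q)
  fr : ∀ b → member (p ▹ q) (size t ↑ʳ b) ≡ member q b
  fr = lookup-++ʳ (marks p) (marks q)

childIn-member : ∀ {t} (m : Mk t) → childIn m ≡ true ⇔ HasNeighbour ⟦ t ⟧ (root t) (member m)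
childIn-member ⟨ b ⟩ = mk⇔ (λ ()) (λ { (_ , _ , ()) })
childIn-member (_▹_ {t} {c} p q) = subst
  (λ b → childIn p ∨ b ≡ true ⇔ HasNeighbour ⟦ t ▹ c ⟧ (root (t ▹ c)) (member (p ▹ q))) (rootIn-member q)
  (hasNeighbour ⟦ t ⟧ ⟦ c ⟧ (root t) (root c) (member (p ▹ q)) (member p) (member q) fl fr (childIn-member p))
  where open Parts p q

dom⇒ : ∀ {t} (m : Mk t) {e₁} → dom m e₁ ≡ true → DominatesFrom ⟦ t ⟧ (root t) e₁ (member m)
dom⇒ ⟨ b ⟩ d zero with ∨-true {b} d
... | inj₁ p = inj₁ p
... | inj₂ p = inj₂ (inj₂ (refl , p))
dom⇒ (_▹_ {t} {c} p q) {e₁} d with ∧-true {dom p (e₁ ∨ rootIn q)} d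
... | dp , dq rewrite sym (rootIn-member p) | sym (rootIn-member q) =
  dominates ⟦ t ⟧ ⟦ c ⟧ (root t) (root c) (member (p ▹ q)) (member p) (member q) fl fr e₁ (dom⇒ p dp) (dom⇒ q dq)
  where open Parts p q

dom⇐ : ∀ {t} (m : Mk t) {e₁} → DominatesFrom ⟦ t ⟧ (root t) e₁ (member m) → dom m e₁ ≡ true
dom⇐ ⟨ b ⟩ D with D zero
... | inj₁ p = ∨-introˡ p
... | inj₂ (inj₂ (_ , p)) = ∨-introʳ {b} p
dom⇐ (_▹_ {t} {c} p q) {e₁} D rewrite sym (rootIn-member p) | sym (rootIn-member q) = ∧-intro
  (dom⇐ p (dominatesˡ ⟦ t ⟧ ⟦ c ⟧ (root t) (root c) (member (p ▹ q)) (member p) (member q) fl fr e₁ D))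
  (dom⇐ q (dominatesʳ ⟦ t ⟧ ⟦ c ⟧ (root t) (root c) (member (p ▹ q)) (member p) (member q) fl fr e₁ D))
  where open Parts p q

valid⇒dom : ∀ {t} (m : Mk t) {e₁ e₂} → valid m e₁ e₂ ≡ true → dom m e₁ ≡ true
valid⇒dom ⟨ b ⟩ v = proj₁ (∧-true v)
valid⇒dom (p ▹ q) {e₁} {e₂} v with ∧-true {valid p (e₁ ∨ rootIn q) (e₂ ∨ childIn q)} v
... | vp , vq = ∧-intro (valid⇒dom p vp) (valid⇒dom q vq)

valid⇒paired : ∀ {t} (m : Mk t) {e₁ e₂} → valid m e₁ e₂ ≡ true → PairedFrom ⟦ t ⟧ (root t) e₁ e₂ (member m)
valid⇒paired ⟨ true ⟩ v zero refl = inj₂ (inj₁ (refl , v))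
valid⇒paired ⟨ false ⟩ v zero ()
valid⇒paired (_▹_ {t} {c} p q) {e₁} {e₂} v with ∧-true {valid p (e₁ ∨ rootIn q) (e₂ ∨ childIn q)} v
... | vp , vq rewrite sym (rootIn-member p) | sym (rootIn-member q) =
  paired ⟦ t ⟧ ⟦ c ⟧ (root t) (root c) (member (p ▹ q)) (member p) (member q) fl fr e₁ e₂
    (childIn p) (childIn q) (childIn-member p) (childIn-member q)
    (valid⇒paired p vp) (valid⇒paired q vq)
  where open Parts p q

valid⇐ : ∀ {t} (m : Mk t) {e₁ e₂} → dom m e₁ ≡ true → PairedFrom ⟦ t ⟧ (root t) e₁ e₂ (member m) → valid m e₁ e₂ ≡ true
valid⇐ ⟨ false ⟩ d P = ∧-intro d refl
valid⇐ ⟨ true ⟩ d P with P zero refl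
... | inj₁ (_ , _ , _ , inj₁ ())
... | inj₁ (_ , _ , _ , inj₂ (_ , () , _))
... | inj₂ (inj₁ (_ , p)) = p
... | inj₂ (inj₂ (() , _))
valid⇐ (_▹_ {t} {c} p q) {e₁} {e₂} d P with ∧-true {dom p (e₁ ∨ rootIn q)} d
... | dp , dq rewrite sym (rootIn-member p) | sym (rootIn-member q) = ∧-intro
  (valid⇐ p dp (pairedˡ ⟦ t ⟧ ⟦ c ⟧ (root t) (root c) (member (p ▹ q)) (member p) (member q) fl fr e₁ e₂
    (childIn p) (childIn q) (childIn-member p) (childIn-member q) P))
  (valid⇐ q dq (pairedʳ ⟦ t ⟧ ⟦ c ⟧ (root t) (root c) (member (p ▹ q)) (member p) (member q) fl fr e₁ e₂
    (childIn p) (childIn q) (childIn-member p) (childIn-member q) P))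
  where open Parts p q

marks-surjective : ∀ t (S : Subset (size t)) → ∃[ m ] marks {t} m ≡ S
marks-surjective • (b ∷ []) = ⟨ b ⟩ , refl
marks-surjective (t ▹ c) S with Vec.splitAt (size t) S
... | p , q , refl with marks-surjective t p | marks-surjective c q
...   | p′ , refl | q′ , refl = p′ ▹ q′ , refl

∣++∣ : (p : Subset n) (q : Subset m) → ∣ p ++ q ∣ ≡ ∣ p ∣ + ∣ q ∣
∣++∣ [] q = refl
∣++∣ (inside ∷ p) q = cong suc (∣++∣ p q)
∣++∣ (outside ∷ p) q = ∣++∣ p q

∣marks∣ : ∀ {t} (m : Mk t) → ∣ marks m ∣ ≡ # m
∣marks∣ ⟨ true ⟩ = refl
∣marks∣ ⟨ false ⟩ = refl
∣marks∣ (p ▹ q) = trans (∣++∣ (marks p) (marks q)) (cong₂ _+_ (∣marks∣ p) (∣marks∣ q))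

module _ {n} {G : Graph n} {S : Subset n} where

  member? : ∀ w → w ∈ S ⊎ w ∉ S
  member? w with lookup S w in e
  ... | true = inj₁ (lookup⇒[]= w S e)
  ... | false = inj₂ (λ w∈S → true≢false ([]=⇒lookup w∈S) e)

  dominatesFrom⇒ : ∀ {v} → DominatesFrom G v false (lookup S) → Dominating G S
  dominatesFrom⇒ D w w∉S with D w
  ... | inj₁ p = ⊥-elim (w∉S (lookup⇒[]= w S p))
  ... | inj₂ (inj₁ (u , p , uw)) = u , lookup⇒[]= u S p , uw

  dominatesFrom⇐ : ∀ {v} → Dominating G S → DominatesFrom G v false (lookup S)
  dominatesFrom⇐ D w with member? w
  ... | inj₁ p = inj₁ ([]=⇒lookup p)
  ... | inj₂ w∉S with D w w∉S
  ...   | u , p , uw = inj₂ (inj₁ (u , []=⇒lookup p , uw))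

  -- Almost domination relative to `v` is domination with a fictitious outside neighbour of `v` in
  -- the set.
  almost⇒ : ∀ {v} → DominatesFrom G v true (lookup S) → AlmostDominating G v S
  almost⇒ D w w≢v w∉S with D w
  ... | inj₁ p = ⊥-elim (w∉S (lookup⇒[]= w S p))
  ... | inj₂ (inj₁ (u , p , uw)) = u , lookup⇒[]= u S p , uw
  ... | inj₂ (inj₂ (w≡v , _)) = ⊥-elim (w≢v w≡v)

  almost⇐ : ∀ {v} → AlmostDominating G v S → DominatesFrom G v true (lookup S)
  almost⇐ {v} D w with member? w | w ≟ v
  ... | inj₁ p | _ = inj₁ ([]=⇒lookup p)
  ... | inj₂ _ | yes w≡v = inj₂ (inj₂ (w≡v , refl))
  ... | inj₂ w∉S | no w≢v with D w w≢v w∉S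
  ...   | u , p , uw = inj₂ (inj₁ (u , []=⇒lookup p , uw))

  semitotal⇒ : ∀ {v} → DominatesFrom G v false (lookup S) → PairedFrom G v false false (lookup S) → SemitotalDominating G S
  semitotal⇒ {v} D P = dominatesFrom⇒ D , paired′
    where
    paired′ : ∀ u → u ∈ S → ∃[ w ] (w ∈ S × u ≢ w × Within2 G u w)
    paired′ u u∈S with P u ([]=⇒lookup u∈S)
    ... | inj₁ (w , p , q) = w , lookup⇒[]= w S p , q
    ... | inj₂ (inj₁ (_ , ()))
    ... | inj₂ (inj₂ (_ , ()))

  semitotal⇐ : ∀ {v} → SemitotalDominating G S → PairedFrom G v false false (lookup S)
  semitotal⇐ (_ , P) u fu with P u (lookup⇒[]= u S fu)
  ... | w , p , q = inj₁ (w , []=⇒lookup p , q)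

  dominatesFrom-mono : ∀ {v e₁ e₁′} → (e₁ ≡ true → e₁′ ≡ true) → DominatesFrom G v e₁ (lookup S) → DominatesFrom G v e₁′ (lookup S)
  dominatesFrom-mono le D w with D w
  ... | inj₁ p = inj₁ p
  ... | inj₂ (inj₁ p) = inj₂ (inj₁ p)
  ... | inj₂ (inj₂ (e , p)) = inj₂ (inj₂ (e , le p))

  pairedFrom-mono : ∀ {v e₁ e₂} → PairedFrom G v false false (lookup S) → PairedFrom G v e₁ e₂ (lookup S)
  pairedFrom-mono P u fu with P u fu
  ... | inj₁ p = inj₁ p
  ... | inj₂ (inj₁ (_ , ()))
  ... | inj₂ (inj₂ (_ , ()))

valid⇒semitotal : ∀ {t} (m : Mk t) → valid m false false ≡ true → SemitotalDominating ⟦ t ⟧ (marks m)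
valid⇒semitotal m v = semitotal⇒ (dom⇒ m (valid⇒dom m v)) (valid⇒paired m v)

semitotal⇒valid : ∀ {t} (m : Mk t) → SemitotalDominating ⟦ t ⟧ (marks m) → valid m false false ≡ true
semitotal⇒valid m SD = valid⇐ m (dom⇐ m (dominatesFrom⇐ (proj₁ SD))) (semitotal⇐ {S = marks m} SD)

dom⇒dominating : ∀ {t} (m : Mk t) → dom m false ≡ true → Dominating ⟦ t ⟧ (marks m)
dom⇒dominating m d = dominatesFrom⇒ (dom⇒ m d)

dominating⇒dom : ∀ {t} (m : Mk t) → Dominating ⟦ t ⟧ (marks m) → dom m false ≡ true
dominating⇒dom m D = dom⇐ m (dominatesFrom⇐ D)

-- Transport along isomorphisms

module Transfer {n m} {G : Graph n} {H : Graph m} (I : G ≅ H) where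
  open Inverse (_≅_.bij I)

  image : Subset n → Subset m
  image S = tabulate (lookup S ∘ from)

  image-lookup : ∀ S j → lookup (image S) j ≡ lookup S (from j)
  image-lookup S = lookup∘tabulate (lookup S ∘ from)

  image∈ : ∀ {S i} → i ∈ S → to i ∈ image S
  image∈ {S} {i} i∈S = lookup⇒[]= (to i) (image S) (trans (image-lookup S (to i)) (trans (cong (lookup S) (inverseʳ refl)) ([]=⇒lookup i∈S)))

  ∈image : ∀ {S j} → j ∈ image S → from j ∈ S
  ∈image {S} {j} p = lookup⇒[]= (from j) S (trans (sym (image-lookup S j)) ([]=⇒lookup p))

  image∉ : ∀ {S j} → j ∉ image S → from j ∉ S
  image∉ {S} {j} j∉ p = j∉ (subst (_∈ image S) (inverseˡ refl) (image∈ p))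

  ∣image∣ : ∀ S → ∣ image S ∣ ≡ ∣ S ∣
  ∣image∣ S = trans (card≡sum (lookup S ∘ from)) (trans (sym (sum-permute (indicator ∘ lookup S) (_≅_.bij (≅-sym I))))
    (trans (sym (card≡sum (lookup S))) (cong ∣_∣ (tabulate∘lookup S))))

  adj : ∀ {i j} → Adj G i j → Adj H (to i) (to j)
  adj {i} {j} e = trans (sym (_≅_.preserve I i j)) e

  dominating : ∀ {S} → Dominating G S → Dominating H (image S)
  dominating D w w∉ with D (from w) (image∉ w∉)
  ... | u , u∈S , uw = to u , image∈ u∈S , subst (Adj H (to u)) (inverseˡ refl) (adj uw)

  semitotal : ∀ {S} → SemitotalDominating G S → SemitotalDominating H (image S)
  semitotal {S} (D , P) = dominating D , λ u u∈ → partner u (P (from u) (∈image u∈))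
    where
    partner : ∀ u → ∃[ w ] (w ∈ S × from u ≢ w × Within2 G (from u) w) → ∃[ w ] (w ∈ image S × u ≢ w × Within2 H u w)
    partner u (w , w∈S , u≢w , near) = to w , image∈ w∈S , (λ e → u≢w (trans (cong from e) (inverseʳ refl))) , go near
      where
      go : Within2 G (from u) w → Within2 H u (to w)
      go (inj₁ e) = inj₁ (subst (λ z → Adj H z (to w)) (inverseˡ refl) (adj e))
      go (inj₂ (y , uy , yw)) = inj₂ (to y , subst (λ z → Adj H z (to y)) (inverseˡ refl) (adj uy) , adj yw)

isMinCard-transfer : {P : Subset n → Set} {Q : Subset m → Set}
  (f : Subset n → Subset m) (g : Subset m → Subset n) → (∀ S → ∣ f S ∣ ≡ ∣ S ∣) → (∀ S → ∣ g S ∣ ≡ ∣ S ∣) →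
  (∀ S → P S → Q (f S)) → (∀ S → Q S → P (g S)) → ∀ {k} → IsMinCard P k → IsMinCard Q k
isMinCard-transfer f g ∣f∣ ∣g∣ pq qp ((S , p , e) , low) =
  (f S , pq S p , trans (∣f∣ S) e) , λ S′ q → ≤-trans (low (g S′) (qp S′ q)) (≤-reflexive (∣g∣ S′))

gammaEq-≅ : {G : Graph n} {H : Graph m} → G ≅ H → GammaEqGammaT2 G → GammaEqGammaT2 H
gammaEq-≅ I (k , d , s) = k ,
  isMinCard-transfer A.image B.image A.∣image∣ B.∣image∣ (λ _ → A.dominating) (λ _ → B.dominating) d ,
  isMinCard-transfer A.image B.image A.∣image∣ B.∣image∣ (λ _ → A.semitotal) (λ _ → B.semitotal) s
  where
  module A = Transfer I
  module B = Transfer (≅-sym I)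

-- The operations preserve equality

attach-symmetric : {G : Graph n} {H : Graph m} (v : Fin n) (h : Fin m) →
  (∀ i j → G i j ≡ G j i) → (∀ i j → H i j ≡ H j i) → ∀ i j → attach G H v h i j ≡ attach G H v h j i
attach-symmetric {n} v h sG sH i j with splitAt n i | splitAt n j
... | inj₁ a | inj₁ b = sG a b
... | inj₂ a | inj₂ b = sH a b
... | inj₁ a | inj₂ b = refl
... | inj₂ a | inj₁ b = refl

path-symmetric : ∀ i j → path k i j ≡ path k j i
path-symmetric i j = ∨-comm ((toℕ i + 1) ≡ᵇ toℕ j) ((toℕ j + 1) ≡ᵇ toℕ i)

Y-symmetric : ∀ i j → Ygraph i j ≡ Ygraph j i
Y-symmetric i j = ∨-comm (yEdge i j) (yEdge j i)

==-comm : (a b : Fin n) → (a == b) ≡ (b == a)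
==-comm a b with a ≟ b
... | yes refl = sym (==-refl a)
... | no a≢b = sym (≢⇒== (a≢b ∘ sym))

subdividedStar-symmetric : ∀ t i j → subdividedStar t i j ≡ subdividedStar t j i
subdividedStar-symmetric t i j = go (xVertex {t} i) (xVertex {t} j)
  where
  go : ∀ p q → xAdj p q ≡ xAdj {t} q p
  go center center = refl
  go center (mid _) = refl
  go center (leaf _) = refl
  go (mid _) center = refl
  go (mid _) (mid _) = refl
  go (mid a) (leaf b) = ==-comm a b
  go (leaf _) center = refl
  go (leaf a) (mid b) = ==-comm a b
  go (leaf _) (leaf _) = refl

-- Serves the attachment of P₂: domination supplies an edge into `v`, while the partner of the new
-- member is reached by an edge out of `v`.
InO-symmetric : {T : Graph n} → InO T → ∀ i j → T i j ≡ T j i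
InO-symmetric base = path-symmetric
InO-symmetric (op1 o v _) = attach-symmetric v zero (InO-symmetric o) (λ _ _ → refl)
InO-symmetric (op2a o v _) = attach-symmetric v zero (InO-symmetric o) path-symmetric
InO-symmetric (op2b o v _) = attach-symmetric v zero (InO-symmetric o) path-symmetric
InO-symmetric (op3 o t _ v) = attach-symmetric v zero (InO-symmetric o) (subdividedStar-symmetric t)
InO-symmetric (op4 o v) = attach-symmetric v zero (InO-symmetric o) Y-symmetric
InO-symmetric (iso o I) i j = trans (≅-preserve i j) (trans (InO-symmetric o _ _) (sym (≅-preserve j i)))
  where ≅-preserve = _≅_.preserve (≅-sym (Iso⇒≅ I))

hasNeighbour? : (G : Graph n) (v : Fin n) (f : Fin n → Bool) → ∃[ b ] (b ≡ true ⇔ HasNeighbour G v f)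
hasNeighbour? G v f with any? (λ w → (f w Bool.≟ true) ×-dec (G v w Bool.≟ true))
... | yes p = true , mk⇔ (λ _ → p) (λ _ → refl)
... | no ¬p = false , mk⇔ (λ ()) (⊥-elim ∘ ¬p)

∣update∣ : (S : Subset n) (v : Fin n) → ∣ S [ v ]≔ true ∣ ≤ suc ∣ S ∣
∣update∣ (true ∷ S) zero = n≤1+n _
∣update∣ (false ∷ S) zero = ≤-refl
∣update∣ (true ∷ S) (suc v) = s≤s (∣update∣ S v)
∣update∣ (false ∷ S) (suc v) = ∣update∣ S v

update-member : (S : Subset n) (v : Fin n) {u : Fin n} → lookup S u ≡ true → lookup (S [ v ]≔ true) u ≡ true
update-member S v {u} e with u ≟ v
... | yes refl = lookup∘update v S true
... | no u≢v = trans (lookup∘update′ u≢v S true) e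

-- If `v` is dominated only from outside, adding `v` itself repairs this at the price of one member.
dominatesFrom-bound : {G : Graph n} {v : Fin n} {S : Subset n} {e : Bool} → (∀ S → Dominating G S → k ≤ ∣ S ∣) →
  DominatesFrom G v e (lookup S) → k ≤ ∣ S ∣ + indicator e
dominatesFrom-bound {S = S} {false} low D = ≤-trans (low S (dominatesFrom⇒ D)) (m≤m+n _ 0)
dominatesFrom-bound {G = G} {v} {S} {true} low D =
  ≤-trans (low (S [ v ]≔ true) (dominatesFrom⇒ {v = v} D′)) (≤-trans (∣update∣ S v) (≤-reflexive (+-comm 1 _)))
  where
  D′ : DominatesFrom G v false (lookup (S [ v ]≔ true))
  D′ w with D w
  ... | inj₁ p = inj₁ (update-member S v p)
  ... | inj₂ (inj₁ (u , p , uw)) = inj₂ (inj₁ (u , update-member S v p , uw))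
  ... | inj₂ (inj₂ (refl , _)) = inj₁ (lookup∘update v S true)

module _ {T : Graph n} {H : Graph m} (v : Fin n) (h : Fin m) where

  private
    module At (p : Subset n) (q : Subset m) where
      fl = lookup-++ˡ p q
      fr = lookup-++ʳ p q

  attach-dominating : {D : Subset n} {E : Subset m} {e : Bool} → DominatesFrom T v e (lookup D) →
    (e ≡ true → lookup E h ≡ true) → DominatesFrom H h (lookup D v) (lookup E) → Dominating (attach T H v h) (D ++ E)
  attach-dominating {D} {E} DT le DH = dominatesFrom⇒
    (dominates T H v h (lookup (D ++ E)) (lookup D) (lookup E) fl fr false (dominatesFrom-mono {S = D} le DT) DH)
    where open At D E

  attach-split : ∀ {S} → Dominating (attach T H v h) S → ∃[ D ] ∃[ E ] (S ≡ D ++ E ×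
    DominatesFrom T v (lookup E h) (lookup D) × DominatesFrom H h (lookup D v) (lookup E))
  attach-split {S} Dom with Vec.splitAt n S
  ... | D , E , refl = D , E , refl ,
      dominatesˡ T H v h _ (lookup D) (lookup E) fl fr false (dominatesFrom⇐ Dom) ,
      dominatesʳ T H v h _ (lookup D) (lookup E) fl fr false (dominatesFrom⇐ Dom)
    where open At D E

  -- One set serves both numbers: `D ++ E` is semitotal and no larger than any dominating set, and
  -- the latter is compared through its two restrictions.
  attach-gammaEq : {D : Subset n} {E : Subset m} → SemitotalDominating T D → DominatesFrom H h (lookup D v) (lookup E) →
    (∀ xG → xG ≡ true ⇔ HasNeighbour T v (lookup D) → PairedFrom H h (lookup D v) xG (lookup E)) →
    (∀ D′ E′ → DominatesFrom T v (lookup E′ h) (lookup D′) → DominatesFrom H h (lookup D′ v) (lookup E′) →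
      ∣ D ∣ + ∣ E ∣ ≤ ∣ D′ ∣ + ∣ E′ ∣) →
    GammaEqGammaT2 (attach T H v h)
  attach-gammaEq {D} {E} SD DH PH low =
    ∣ D ++ E ∣ , ((D ++ E , proj₁ sd , refl) , low′) , ((D ++ E , sd , refl) , λ S → low′ S ∘ proj₁)
    where
    open At D E
    sd : SemitotalDominating (attach T H v h) (D ++ E)
    sd = attach-dominating {D} {E} (dominatesFrom⇐ {v = v} (proj₁ SD)) (λ ()) DH ,
      proj₂ (semitotal⇒ {v = v ↑ˡ m} (dominates T H v h _ (lookup D) (lookup E) fl fr false
          (dominatesFrom-mono {S = D} (λ ()) (dominatesFrom⇐ {v = v} (proj₁ SD))) DH)
        (paired T H v h _ (lookup D) (lookup E) fl fr false false (proj₁ xG) (proj₁ xH) (proj₂ xG) (proj₂ xH)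
          (pairedFrom-mono {S = D} (semitotal⇐ {v = v} SD))
          (subst (λ b → PairedFrom H h (lookup D v) b (lookup E)) (sym (∨-identityʳ _)) (PH (proj₁ xG) (proj₂ xG)))))
      where
      xG = hasNeighbour? T v (lookup D)
      xH = hasNeighbour? H h (lookup E)
    low′ : ∀ S → Dominating (attach T H v h) S → ∣ D ++ E ∣ ≤ ∣ S ∣
    low′ S Dom with attach-split Dom
    ... | D′ , E′ , refl , DT , DH′ rewrite ∣++∣ D E | ∣++∣ D′ E′ = low D′ E′ DT DH′

module _ {T : Graph n} {H : Graph m} {v : Fin n} {h : Fin m} {D : Subset n} (SD : SemitotalDominating T D)
         (low : ∀ S → Dominating T S → ∣ D ∣ ≤ ∣ S ∣)
         {E : Subset m} (DH : DominatesFrom H h (lookup D v) (lookup E))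
         (PH : ∀ xG → xG ≡ true ⇔ HasNeighbour T v (lookup D) → PairedFrom H h (lookup D v) xG (lookup E)) where

  -- When the old part of a dominating set leaves `v` to `h`, it may be one member short. By the
  -- hypothesis on `H`, having `h` in the set costs one extra member there, which pays for the loss.
  attach-gammaEq-rigid : (∀ E′ {e} → DominatesFrom H h e (lookup E′) → ∣ E ∣ + indicator (lookup E′ h) ≤ ∣ E′ ∣) →
    GammaEqGammaT2 (attach T H v h)
  attach-gammaEq-rigid lowH = attach-gammaEq v h {D} {E} SD DH PH λ D′ E′ DT DH′ → begin
    ∣ D ∣ + ∣ E ∣                                  ≤⟨ +-monoˡ-≤ ∣ E ∣ (dominatesFrom-bound {S = D′} low DT) ⟩
    ∣ D′ ∣ + indicator (lookup E′ h) + ∣ E ∣       ≡⟨ +-assoc ∣ D′ ∣ _ _ ⟩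
    ∣ D′ ∣ + (indicator (lookup E′ h) + ∣ E ∣)     ≡⟨ cong (∣ D′ ∣ +_) (+-comm (indicator (lookup E′ h)) ∣ E ∣) ⟩
    ∣ D′ ∣ + (∣ E ∣ + indicator (lookup E′ h))     ≤⟨ +-monoʳ-≤ ∣ D′ ∣ (lowH E′ DH′) ⟩
    ∣ D′ ∣ + ∣ E′ ∣                                ∎
    where open ≤-Reasoning

  -- An end of P₂ or P₅ lies in a minimum dominating set of the path, so taking `h` costs nothing
  -- extra and the trade of `attach-gammaEq-rigid` breaks down. The bound on the old part comes from
  -- γ(T;v) = γ(T) instead.
  attach-gammaEq-almost : AlmostEqGamma T v → (∀ E′ {e} → DominatesFrom H h e (lookup E′) → ∣ E ∣ ≤ ∣ E′ ∣) →
    GammaEqGammaT2 (attach T H v h)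
  attach-gammaEq-almost (k , ((S , dS , refl) , _) , (_ , lowA)) lowH = attach-gammaEq v h {D} {E} SD DH PH λ D′ E′ DT DH′ →
    +-mono-≤ (≤-trans (low S dS) (lowA D′ (almost⇒ {S = D′} (dominatesFrom-mono {S = D′} (λ _ → refl) DT)))) (lowH E′ DH′)

one-of : ∀ a b → a ≡ true ⊎ b ≡ true → 1 ≤ indicator a + indicator b
one-of _ b (inj₁ refl) = s≤s z≤n
one-of a _ (inj₂ refl) = m≤n+m 1 (indicator a)

∣∷∣ : ∀ b (S : Subset n) → ∣ b ∷ S ∣ ≡ indicator b + ∣ S ∣
∣∷∣ true S = refl
∣∷∣ false S = refl

pairs-bound : (P L : Subset n) → (∀ a → lookup P a ≡ true ⊎ lookup L a ≡ true) → n ≤ ∣ P ∣ + ∣ L ∣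
pairs-bound [] [] _ = z≤n
pairs-bound {suc n} (p ∷ P) (l ∷ L) h = begin
  1 + n                                           ≤⟨ +-mono-≤ (one-of p l (h zero)) (pairs-bound P L (h ∘ suc)) ⟩
  (indicator p + indicator l) + (∣ P ∣ + ∣ L ∣)   ≡⟨ +-assoc (indicator p) _ _ ⟩
  indicator p + (indicator l + (∣ P ∣ + ∣ L ∣))   ≡⟨ cong (indicator p +_) (x∙yz≈y∙xz (indicator l) ∣ P ∣ ∣ L ∣) ⟩
  indicator p + (∣ P ∣ + (indicator l + ∣ L ∣))   ≡⟨ +-assoc (indicator p) _ _ ⟨
  (indicator p + ∣ P ∣) + (indicator l + ∣ L ∣)   ≡⟨ cong₂ _+_ (∣∷∣ p P) (∣∷∣ l L) ⟨
  ∣ p ∷ P ∣ + ∣ l ∷ L ∣                           ∎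
  where
  open ≤-Reasoning

member-bound : (S : Subset n) {i : Fin n} → lookup S i ≡ true → 1 ≤ ∣ S ∣
member-bound (true ∷ S) _ = s≤s z≤n
member-bound (false ∷ S) {suc i} e = member-bound S e

path2-bound : ∀ E {e} → DominatesFrom (path 2) 0F e (lookup E) → 1 ≤ ∣ E ∣
path2-bound E D with D 1F
... | inj₁ p = member-bound E p
... | inj₂ (inj₁ (_ , p , _)) = member-bound E p

-- The second vertex and the far end have disjoint closed neighbourhoods, and neither is the
-- attachment vertex, so help from outside does not reach them.
path5-bound : ∀ E {e} → DominatesFrom (path 5) 0F e (lookup E) → 2 ≤ ∣ E ∣
path5-bound E@(a ∷ b ∷ c ∷ d ∷ e ∷ []) {e₁} D =
  ≤-trans (+-mono-≤ (at-1 (D 1F)) (at-4 (D 4F))) (≤-reflexive (sym (∣++∣ (a ∷ b ∷ c ∷ []) (d ∷ e ∷ []))))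
  where
  at-1 : lookup E 1F ≡ true ⊎ (∃[ u ] (lookup E u ≡ true × Adj (path 5) u 1F)) ⊎ (1F ≡ 0F × e₁ ≡ true) → 1 ≤ ∣ a ∷ b ∷ c ∷ [] ∣
  at-1 (inj₁ p) = member-bound (a ∷ b ∷ c ∷ []) {1F} p
  at-1 (inj₂ (inj₁ (0F , p , _))) = member-bound (a ∷ b ∷ c ∷ []) {0F} p
  at-1 (inj₂ (inj₁ (2F , p , _))) = member-bound (a ∷ b ∷ c ∷ []) {2F} p
  at-4 : lookup E 4F ≡ true ⊎ (∃[ u ] (lookup E u ≡ true × Adj (path 5) u 4F)) ⊎ (4F ≡ 0F × e₁ ≡ true) → 1 ≤ ∣ d ∷ e ∷ [] ∣
  at-4 (inj₁ p) = member-bound (d ∷ e ∷ []) {1F} p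
  at-4 (inj₂ (inj₁ (3F , p , _))) = member-bound (d ∷ e ∷ []) {0F} p
  at-4 (inj₂ (inj₁ (4F , _ , ())))

-- The closed neighbourhoods of the leaves 2 and 4 are disjoint and both miss vertex 0, so a member
-- at 0 comes on top.
Y-bound : ∀ E {e} → DominatesFrom Ygraph 0F e (lookup E) → 2 + indicator (lookup E 0F) ≤ ∣ E ∣
Y-bound E@(a ∷ b ∷ c ∷ d ∷ e ∷ []) {e₁} D = begin
  2 + indicator a                                    ≤⟨ +-monoˡ-≤ (indicator a) (+-mono-≤ (at-2 (D 2F)) (at-4 (D 4F))) ⟩
  (∣ b ∷ c ∷ [] ∣ + ∣ d ∷ e ∷ [] ∣) + indicator a    ≡⟨ +-comm _ (indicator a) ⟩
  indicator a + (∣ b ∷ c ∷ [] ∣ + ∣ d ∷ e ∷ [] ∣)    ≡⟨ cong (indicator a +_) (∣++∣ (b ∷ c ∷ []) (d ∷ e ∷ [])) ⟨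
  indicator a + ∣ b ∷ c ∷ d ∷ e ∷ [] ∣               ≡⟨ ∣∷∣ a (b ∷ c ∷ d ∷ e ∷ []) ⟨
  ∣ E ∣                                              ∎
  where
  open ≤-Reasoning
  at-2 : lookup E 2F ≡ true ⊎ (∃[ u ] (lookup E u ≡ true × Adj Ygraph u 2F)) ⊎ (2F ≡ 0F × e₁ ≡ true) → 1 ≤ ∣ b ∷ c ∷ [] ∣
  at-2 (inj₁ p) = member-bound (b ∷ c ∷ []) {1F} p
  at-2 (inj₂ (inj₁ (1F , p , _))) = member-bound (b ∷ c ∷ []) {0F} p
  at-2 (inj₂ (inj₁ (2F , _ , ())))
  at-2 (inj₂ (inj₁ (3F , _ , ())))
  at-2 (inj₂ (inj₁ (4F , _ , ())))
  at-4 : lookup E 4F ≡ true ⊎ (∃[ u ] (lookup E u ≡ true × Adj Ygraph u 4F)) ⊎ (4F ≡ 0F × e₁ ≡ true) → 1 ≤ ∣ d ∷ e ∷ [] ∣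
  at-4 (inj₁ p) = member-bound (d ∷ e ∷ []) {1F} p
  at-4 (inj₂ (inj₁ (3F , p , _))) = member-bound (d ∷ e ∷ []) {0F} p
  at-4 (inj₂ (inj₁ (4F , _ , ())))

module SubdividedStar (t : ℕ) where

  mid′ leaf′ : Fin t → Fin (suc (t + t))
  mid′ a = suc (a ↑ˡ t)
  leaf′ a = suc (t ↑ʳ a)

  center-mid : ∀ a → Adj (subdividedStar t) zero (mid′ a)
  center-mid a rewrite splitAt-↑ˡ t a t = refl

  mid-center : ∀ a → Adj (subdividedStar t) (mid′ a) zero
  mid-center a rewrite splitAt-↑ˡ t a t = refl

  mid-leaf : ∀ a b → subdividedStar t (mid′ a) (leaf′ b) ≡ (a == b)
  mid-leaf a b rewrite splitAt-↑ˡ t a t | splitAt-↑ʳ t t b = refl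

  leaf-leaf : ∀ a b → subdividedStar t (leaf′ a) (leaf′ b) ≡ false
  leaf-leaf a b rewrite splitAt-↑ʳ t t a | splitAt-↑ʳ t t b = refl

  center-leaf : ∀ b → subdividedStar t zero (leaf′ b) ≡ false
  center-leaf b rewrite splitAt-↑ʳ t t b = refl

  mids : Subset (suc (t + t))
  mids = outside ∷ (replicate t inside ++ replicate t outside)

  ∣mids∣ : ∣ mids ∣ ≡ t
  ∣mids∣ = trans (∣++∣ (replicate t inside) (replicate t outside))
    (trans (cong₂ _+_ (∣⊤∣≡n t) (∣⊥∣≡0 t)) (+-identityʳ t))

  mids-mid : ∀ a → lookup mids (mid′ a) ≡ true
  mids-mid a = trans (lookup-++ˡ (replicate t inside) (replicate t outside) a) (lookup-replicate a inside)

  mids-leaf : ∀ a → lookup mids (leaf′ a) ≡ false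
  mids-leaf a = trans (lookup-++ʳ (replicate t inside) (replicate t outside) a) (lookup-replicate a outside)

  mids-dominate : 1 ≤ t → ∀ {e} → DominatesFrom (subdividedStar t) zero e (lookup mids)
  mids-dominate (s≤s _) zero = inj₂ (inj₁ (mid′ zero , mids-mid zero , mid-center zero))
  mids-dominate _ (suc i) with splitView t t i
  ... | left a = inj₁ (mids-mid a)
  ... | right a = inj₂ (inj₁ (mid′ a , mids-mid a , trans (mid-leaf a a) (==-refl a)))

  another : 2 ≤ t → (a : Fin t) → ∃[ b ] a ≢ b
  another (s≤s (s≤s _)) zero = suc zero , λ ()
  another (s≤s (s≤s _)) (suc a) = zero , λ ()

  mids-paired : 2 ≤ t → ∀ {e₁ e₂} → PairedFrom (subdividedStar t) zero e₁ e₂ (lookup mids)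
  mids-paired 2≤t (suc i) p with splitView t t i
  ... | right a = true≢false p (mids-leaf a)
  ... | left a with another 2≤t a
  ...   | b , a≢b = inj₁ (mid′ b , mids-mid b , a≢b ∘ ↑ˡ-injective t a b ∘ Fin-suc-injective ,
            inj₂ (zero , mid-center a , center-mid b))

  -- Every leg, consisting of a middle vertex and its leaf, needs a member to dominate the leaf; the
  -- centre belongs to no leg and counts extra.
  star-bound : ∀ E {e} → DominatesFrom (subdividedStar t) zero e (lookup E) → t + indicator (lookup E zero) ≤ ∣ E ∣
  star-bound (c ∷ S) {e} D with Vec.splitAt t S
  ... | P , L , refl = begin
    t + indicator c                   ≡⟨ +-comm t _ ⟩
    indicator c + t                   ≤⟨ +-monoʳ-≤ (indicator c) (pairs-bound P L pair) ⟩
    indicator c + (∣ P ∣ + ∣ L ∣)     ≡⟨ cong (indicator c +_) (∣++∣ P L) ⟨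
    indicator c + ∣ P ++ L ∣          ≡⟨ ∣∷∣ c (P ++ L) ⟨
    ∣ c ∷ P ++ L ∣                    ∎
    where
    open ≤-Reasoning
    pair : ∀ a → lookup P a ≡ true ⊎ lookup L a ≡ true
    pair a with D (leaf′ a)
    ... | inj₁ p = inj₂ (trans (sym (lookup-++ʳ P L a)) p)
    ... | inj₂ (inj₁ (zero , _ , uw)) = true≢false uw (center-leaf a)
    ... | inj₂ (inj₁ (suc i , p , uw)) with splitView t t i
    ...   | right b = true≢false uw (leaf-leaf b a)
    ...   | left b with ==⇒≡ {a = b} {a} (trans (sym (mid-leaf b a)) uw)
    ...     | refl = inj₁ (trans (sym (lookup-++ˡ P L a)) p)

InO⇒gammaEq : {T : Graph n} → InO T → GammaEqGammaT2 T
InO⇒gammaEq base = 2 , ((S , proj₁ sd , refl) , low) , ((S , sd , refl) , λ S′ → low S′ ∘ proj₁)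
  where
  S : Subset 4
  S = outside ∷ inside ∷ inside ∷ outside ∷ []
  sd : SemitotalDominating (path 4) S
  sd = semitotal⇒ {G = path 4} {S = S} {v = 0F}
    (λ { 0F → inj₂ (inj₁ (1F , refl , refl)) ; 1F → inj₁ refl ; 2F → inj₁ refl ; 3F → inj₂ (inj₁ (2F , refl , refl)) })
    (λ { 1F _ → inj₁ (2F , refl , (λ ()) , inj₁ refl) ; 2F _ → inj₁ (1F , refl , (λ ()) , inj₁ refl) ; 3F () })
  low : ∀ S → Dominating (path 4) S → 2 ≤ ∣ S ∣
  low S@(a ∷ b ∷ c ∷ d ∷ []) D = ≤-trans (+-mono-≤ (at-0 (D′ 0F)) (at-3 (D′ 3F))) (≤-reflexive (sym (∣++∣ (a ∷ b ∷ []) (c ∷ d ∷ []))))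
    where
    D′ : DominatesFrom (path 4) 0F false (lookup S)
    D′ = dominatesFrom⇐ D
    at-0 : lookup S 0F ≡ true ⊎ (∃[ u ] (lookup S u ≡ true × Adj (path 4) u 0F)) ⊎ (0F ≡ 0F × false ≡ true) → 1 ≤ ∣ a ∷ b ∷ [] ∣
    at-0 (inj₁ p) = member-bound (a ∷ b ∷ []) {0F} p
    at-0 (inj₂ (inj₁ (1F , p , _))) = member-bound (a ∷ b ∷ []) {1F} p
    at-3 : lookup S 3F ≡ true ⊎ (∃[ u ] (lookup S u ≡ true × Adj (path 4) u 3F)) ⊎ (3F ≡ 0F × false ≡ true) → 1 ≤ ∣ c ∷ d ∷ [] ∣
    at-3 (inj₁ p) = member-bound (c ∷ d ∷ []) {1F} p
    at-3 (inj₂ (inj₁ (2F , p , _))) = member-bound (c ∷ d ∷ []) {0F} p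
    at-3 (inj₂ (inj₁ (3F , _ , ())))
InO⇒gammaEq (op1 o v (D , (SD , minD) , v∈D)) with InO⇒gammaEq o
... | k , (_ , low) , ((D₀ , SD₀ , refl) , _) =
  -- `D` is the given γt2-set through `v`; by the induction hypothesis it is also a minimum
  -- dominating set.
  attach-gammaEq-rigid SD (λ S dS → ≤-trans (minD D₀ SD₀) (low S dS)) {outside ∷ []}
    (λ { zero → inj₂ (inj₂ (refl , []=⇒lookup v∈D)) }) (λ _ _ → λ { zero () })
    (λ { (true ∷ []) _ → ≤-refl ; (false ∷ []) _ → ≤-refl })
InO⇒gammaEq {T = T′} (op2a {T = T} o v almost) with InO⇒gammaEq o
... | k , (_ , low) , ((D , SD , refl) , _) =
  -- The new member is the vertex next to `v`. As `D` dominates `v`, it finds a partner at `v` or at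
  -- a neighbour of `v`.
  attach-gammaEq-almost SD low {inside ∷ outside ∷ []}
    (λ { 0F → inj₁ refl ; 1F → inj₂ (inj₁ (0F , refl , refl)) })
    (λ xG XG → λ { 0F _ → inj₂ (inj₁ (refl , near xG XG (dominatesFrom⇐ {S = D} {v = v} (proj₁ SD) v))) ; 1F () })
    almost path2-bound
  where
  near : ∀ xG → xG ≡ true ⇔ HasNeighbour T v (lookup D) →
    lookup D v ≡ true ⊎ (∃[ u ] (lookup D u ≡ true × Adj T u v)) ⊎ (v ≡ v × false ≡ true) → lookup D v ∨ xG ≡ true
  near xG XG (inj₁ p) = ∨-introˡ p
  near xG XG (inj₂ (inj₁ (u , p , uv))) = ∨-introʳ {lookup D v} (Equivalence.from XG (u , p , trans (InO-symmetric o v u) uv))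
InO⇒gammaEq (op2b o v almost) with InO⇒gammaEq o
... | k , (_ , low) , ((D , SD , refl) , _) =
  -- The second and the fourth vertex of P₅ have a common neighbour, so they are partners whatever
  -- `D` is.
  attach-gammaEq-almost SD low {outside ∷ inside ∷ outside ∷ inside ∷ outside ∷ []}
    (λ { 0F → inj₂ (inj₁ (1F , refl , refl)) ; 1F → inj₁ refl ; 2F → inj₂ (inj₁ (1F , refl , refl))
       ; 3F → inj₁ refl ; 4F → inj₂ (inj₁ (3F , refl , refl)) })
    (λ _ _ → λ { 1F _ → inj₁ (3F , refl , (λ ()) , inj₂ (2F , refl , refl))
               ; 3F _ → inj₁ (1F , refl , (λ ()) , inj₂ (2F , refl , refl)) ; 4F () })
    almost path5-bound
InO⇒gammaEq (op3 o t 2≤t v) with InO⇒gammaEq o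
... | k , (_ , low) , ((D , SD , refl) , _) =
  attach-gammaEq-rigid SD low {mids} (mids-dominate (≤-trans (n≤1+n 1) 2≤t)) (λ _ _ → mids-paired 2≤t)
    (λ E d → ≤-trans (≤-reflexive (cong (_+ indicator (lookup E zero)) ∣mids∣)) (star-bound E d))
  where open SubdividedStar t
InO⇒gammaEq (op4 o v) with InO⇒gammaEq o
... | k , (_ , low) , ((D , SD , refl) , _) =
  attach-gammaEq-rigid SD low {outside ∷ inside ∷ outside ∷ inside ∷ outside ∷ []}
    (λ { 0F → inj₂ (inj₁ (1F , refl , refl)) ; 1F → inj₁ refl ; 2F → inj₂ (inj₁ (1F , refl , refl))
       ; 3F → inj₁ refl ; 4F → inj₂ (inj₁ (3F , refl , refl)) })
    (λ _ _ → λ { 1F _ → inj₁ (3F , refl , (λ ()) , inj₁ refl) ; 3F _ → inj₁ (1F , refl , (λ ()) , inj₁ refl) ; 4F () })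
    Y-bound
InO⇒gammaEq (iso o I) = gammaEq-≅ (Iso⇒≅ I) (InO⇒gammaEq o)

-- Undoing the operations

-- Markings of the part of a tree outside the hole.
data MCtx : Ctx → Set where
  top  : MCtx top
  _◃▹_ : MCtx κ → Mk c → MCtx (κ ◃▹ c)
  _▹◃_ : MCtx κ → Mk t → MCtx (κ ▹◃ t)

plugM : MCtx κ → Mk s → Mk (plug κ s)
plugM top p = p
plugM (K ◃▹ q) p = plugM K (p ▹ q)
plugM (K ▹◃ p) q = plugM K (p ▹ q)

cost : MCtx κ → ℕ
cost top = 0
cost (K ◃▹ q) = cost K + # q
cost (K ▹◃ p) = cost K + # p

#-plug : (K : MCtx κ) (p : Mk s) → # plugM K p ≡ cost K + # p
#-plug top p = refl
#-plug (K ◃▹ q) p = trans (#-plug K (p ▹ q)) (trans (cong (cost K +_) (+-comm (# p) (# q))) (sym (+-assoc (cost K) (# q) (# p))))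
#-plug (K ▹◃ p) q = trans (#-plug K (p ▹ q)) (sym (+-assoc (cost K) (# p) (# q)))

-- near₁ and near₂: the context has a member at distance 1, respectively 2, from the root of the hole.
near₁ near₂ : MCtx κ → Bool
near₁ top = false
near₁ (K ◃▹ q) = near₁ K ∨ rootIn q
near₁ (K ▹◃ p) = rootIn p
near₂ top = false
near₂ (K ◃▹ q) = near₂ K ∨ childIn q
near₂ (K ▹◃ p) = childIn p ∨ near₁ K

-- The part of validity that concerns the context, when a says that the root of the hole is a member and b that
-- one of its children in the hole is.
validOut : MCtx κ → Bool → Bool → Bool
validOut top a b = true
validOut (K ◃▹ q) a b = validOut K a (b ∨ rootIn q) ∧ valid q a (b ∨ near₁ K)
validOut (K ▹◃ p) a b = validOut K (rootIn p) (childIn p ∨ a) ∧ valid p (near₁ K ∨ a) (near₂ K ∨ b)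

domOut : MCtx κ → Bool → Bool
domOut top a = true
domOut (K ◃▹ q) a = domOut K a ∧ dom q a
domOut (K ▹◃ p) a = domOut K (rootIn p) ∧ dom p (near₁ K ∨ a)

valid-split : (K : MCtx κ) (p : Mk s) → valid (plugM K p) false false ≡ true →
  validOut K (rootIn p) (childIn p) ≡ true × valid p (near₁ K) (near₂ K) ≡ true
valid-split top p v = refl , v
valid-split (K ◃▹ q) p v with valid-split K (p ▹ q) v
... | o , w with ∧-true {valid p (near₁ K ∨ rootIn q) (near₂ K ∨ childIn q)} w
...   | vp , vq = ∧-intro o vq , vp
valid-split (K ▹◃ p) q v with valid-split K (p ▹ q) v
... | o , w with ∧-true {valid p (near₁ K ∨ rootIn q) (near₂ K ∨ childIn q)} w
...   | vp , vq = ∧-intro o vp , vq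

valid-join : (K : MCtx κ) (p : Mk s) → validOut K (rootIn p) (childIn p) ≡ true → valid p (near₁ K) (near₂ K) ≡ true →
  valid (plugM K p) false false ≡ true
valid-join top p _ v = v
valid-join (K ◃▹ q) p o vp with ∧-true {validOut K (rootIn p) (childIn p ∨ rootIn q)} o
... | o′ , vq = valid-join K (p ▹ q) o′ (∧-intro vp vq)
valid-join (K ▹◃ p) q o vq with ∧-true {validOut K (rootIn p) (childIn p ∨ rootIn q)} o
... | o′ , vp = valid-join K (p ▹ q) o′ (∧-intro vp vq)

dom-split : (K : MCtx κ) (p : Mk s) → dom (plugM K p) false ≡ true → domOut K (rootIn p) ≡ true × dom p (near₁ K) ≡ true
dom-split top p d = refl , d
dom-split (K ◃▹ q) p d with dom-split K (p ▹ q) d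
... | o , w with ∧-true {dom p (near₁ K ∨ rootIn q)} w
...   | dp , dq = ∧-intro o dq , dp
dom-split (K ▹◃ p) q d with dom-split K (p ▹ q) d
... | o , w with ∧-true {dom p (near₁ K ∨ rootIn q)} w
...   | dp , dq = ∧-intro o dp , dq

dom-join : (K : MCtx κ) (p : Mk s) → domOut K (rootIn p) ≡ true → dom p (near₁ K) ≡ true → dom (plugM K p) false ≡ true
dom-join top p _ d = d
dom-join (K ◃▹ q) p o dp with ∧-true {domOut K (rootIn p)} o
... | o′ , dq = dom-join K (p ▹ q) o′ (∧-intro dp dq)
dom-join (K ▹◃ p) q o dq with ∧-true {domOut K (rootIn p)} o
... | o′ , dp = dom-join K (p ▹ q) o′ (∧-intro dp dq)

unplug : ∀ κ s (M : Mk (plug κ s)) → ∃[ K ] ∃[ p ] M ≡ plugM {κ} {s} K p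
unplug top s M = top , M , refl
unplug (κ ◃▹ c) s M with unplug κ (s ▹ c) M
... | K , p ▹ q , refl = K ◃▹ q , p , refl
unplug (κ ▹◃ t) s M with unplug κ (t ▹ s) M
... | K , p ▹ q , refl = K ▹◃ p , q , refl

_⇒_ : Bool → Bool → Set
a ⇒ b = a ≡ true → b ≡ true

∨-mono : ∀ {a a′ b b′} → a ⇒ a′ → b ⇒ b′ → (a ∨ b) ⇒ (a′ ∨ b′)
∨-mono {a} {a′} f g p with ∨-true {a} p
... | inj₁ q = ∨-introˡ (f q)
... | inj₂ q = ∨-introʳ {a′} (g q)

dom-mono : (p : Mk s) {e e′ : Bool} → e ⇒ e′ → dom p e ⇒ dom p e′
dom-mono ⟨ b ⟩ f = ∨-mono {b} id f
dom-mono (p ▹ q) {e} f d with ∧-true {dom p (e ∨ rootIn q)} d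
... | dp , dq = ∧-intro (dom-mono p (∨-mono f id) dp) dq

domOut-mono : (K : MCtx κ) {a a′ : Bool} → a ⇒ a′ → domOut K a ⇒ domOut K a′
domOut-mono top f _ = refl
domOut-mono (K ◃▹ q) {a} f d with ∧-true {domOut K a} d
... | o , dq = ∧-intro (domOut-mono K f o) (dom-mono q f dq)
domOut-mono (K ▹◃ p) {a} f d with ∧-true {domOut K (rootIn p)} d
... | o , dp = ∧-intro o (dom-mono p (∨-mono {near₁ K} id f) dp)

-- An outside member at distance 1 from the root is worth at least as much as one at distance 2.
valid-mono : (p : Mk s) {e₁ e₂ e₁′ e₂′ : Bool} → e₁ ⇒ e₁′ → e₂ ⇒ (e₁′ ∨ e₂′) → valid p e₁ e₂ ⇒ valid p e₁′ e₂′
valid-mono ⟨ false ⟩ {e₁} f g v = ∧-intro (f (proj₁ (∧-true {e₁} v))) refl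
valid-mono ⟨ true ⟩ {e₁} f g v with ∨-true {e₁} v
... | inj₁ p = ∨-introˡ (f p)
... | inj₂ p = g p
valid-mono (p ▹ q) {e₁} {e₂} {e₁′} {e₂′} f g v with ∧-true {valid p (e₁ ∨ rootIn q) (e₂ ∨ childIn q)} v
... | vp , vq = ∧-intro (valid-mono p (∨-mono f id) e₂-case vp) (valid-mono q id (∨-introʳ {rootIn p} ∘ ∨-mono {childIn p} id f) vq)
  where
  e₂-case : (e₂ ∨ childIn q) ⇒ ((e₁′ ∨ rootIn q) ∨ (e₂′ ∨ childIn q))
  e₂-case h with ∨-true {e₂} h
  ... | inj₂ y = ∨-introʳ {e₁′ ∨ rootIn q} (∨-introʳ {e₂′} y)
  ... | inj₁ y with ∨-true {e₁′} (g y)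
  ...   | inj₁ z = ∨-introˡ (∨-introˡ z)
  ...   | inj₂ z = ∨-introʳ {e₁′ ∨ rootIn q} (∨-introˡ z)

-- An outside member at distance 2 from the root can be a partner of the root only.
valid-unmarked : (p : Mk s) {e₁ e₂ e₂′ : Bool} → rootIn p ≡ false → valid p e₁ e₂ ⇒ valid p e₁ e₂′
valid-unmarked ⟨ false ⟩ _ v = v
valid-unmarked (p ▹ q) {e₁} {e₂} e v with ∧-true {valid p (e₁ ∨ rootIn q) (e₂ ∨ childIn q)} v
... | vp , vq = ∧-intro (valid-unmarked p e vp) vq

valid-anywhere : (p : Mk s) → valid p false false ≡ true → ∀ e₁ e₂ → valid p e₁ e₂ ≡ true
valid-anywhere p v e₁ e₂ = valid-mono p (λ ()) (λ ()) v

-- The ground for exchanges towards the root: a member at the root of the hole may stand in for one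
-- at a child, since it is nearer to every vertex of the context.
validOut-mono : (K : MCtx κ) {a b a′ b′ : Bool} → a ⇒ a′ → b ⇒ (a′ ∨ b′) → validOut K a b ⇒ validOut K a′ b′
validOut-mono top f g _ = refl
validOut-mono (K ◃▹ q) {a} {b} {a′} {b′} f g v with ∧-true {validOut K a (b ∨ rootIn q)} v
... | o , vq = ∧-intro (validOut-mono K f (λ h → widen (rootIn q) h) o) (valid-mono q f (λ h → widen (near₁ K) h) vq)
  where
  widen : ∀ d → (b ∨ d) ⇒ (a′ ∨ (b′ ∨ d))
  widen d h with ∨-true {b} h
  ... | inj₂ y = ∨-introʳ {a′} (∨-introʳ {b′} y)
  ... | inj₁ y with ∨-true {a′} (g y)
  ...   | inj₁ z = ∨-introˡ z
  ...   | inj₂ z = ∨-introʳ {a′} (∨-introˡ z)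
validOut-mono (K ▹◃ p) {a} {b} {a′} {b′} f g v with ∧-true {validOut K (rootIn p) (childIn p ∨ a)} v
... | o , vp = ∧-intro (validOut-mono K id (∨-introʳ {rootIn p} ∘ ∨-mono {childIn p} id f) o)
  (valid-mono p (∨-mono {near₁ K} id f) widen vp)
  where
  widen : (near₂ K ∨ b) ⇒ ((near₁ K ∨ a′) ∨ (near₂ K ∨ b′))
  widen h with ∨-true {near₂ K} h
  ... | inj₁ y = ∨-introʳ {near₁ K ∨ a′} (∨-introˡ y)
  ... | inj₂ y with ∨-true {a′} (g y)
  ...   | inj₁ z = ∨-introˡ (∨-introʳ {near₁ K} z)
  ...   | inj₂ z = ∨-introʳ {near₁ K ∨ a′} (∨-introʳ {near₂ K} z)

member-embed : (K : MCtx κ) (p : Mk s) (i : Fin (size s)) → member (plugM K p) (embed κ s i) ≡ member p i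
member-embed top p i = refl
member-embed {s = s} (_◃▹_ {c = c} K q) p i = trans (member-embed K (p ▹ q) (i ↑ˡ size c)) (lookup-++ˡ (marks p) (marks q) i)
member-embed {s = s} (_▹◃_ {t = t} K p) q i = trans (member-embed K (p ▹ q) (size t ↑ʳ i)) (lookup-++ʳ (marks p) (marks q) i)

size-positive : ∀ t → 1 ≤ size t
size-positive • = s≤s z≤n
size-positive (t ▹ c) = ≤-trans (size-positive t) (m≤m+n _ _)

size-plug : ∀ κ {s s′} → size s < size s′ → size (plug κ s) < size (plug κ s′)
size-plug top h = h
size-plug (κ ◃▹ c) h = size-plug κ (+-monoˡ-< (size c) h)
size-plug (κ ▹◃ t) h = size-plug κ (+-monoʳ-< (size t) h)

size-plug-▹ : ∀ κ s c → size (plug κ s) < size (plug κ (s ▹ c))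
size-plug-▹ κ s c = size-plug κ (≤-trans (≤-reflexive (+-comm 1 (size s))) (+-monoʳ-≤ (size s) (size-positive c)))

-- M is a semitotal dominating set as small as any dominating set, and smaller trees are already settled.
record Extremal (t : RT) (M : Mk t) : Set where
  field
    ok      : valid M false false ≡ true
    minimal : (M′ : Mk t) → dom M′ false ≡ true → # M ≤ # M′
    smaller : ∀ t′ → size t′ < size t → GammaEqGammaT2 ⟦ t′ ⟧ → InO ⟦ t′ ⟧

open Extremal

gammaEq-marks : (M : Mk t) → valid M false false ≡ true → (∀ S → Dominating ⟦ t ⟧ S → # M ≤ ∣ S ∣) → GammaEqGammaT2 ⟦ t ⟧
gammaEq-marks M v low =
  # M , ((marks M , proj₁ (valid⇒semitotal M v) , ∣marks∣ M) , low) ,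
        ((marks M , valid⇒semitotal M v , ∣marks∣ M) , λ S → low S ∘ proj₁)

module Reduce (κ : Ctx) (s c : RT) {M : Mk (plug κ (s ▹ c))} (ext : Extremal (plug κ (s ▹ c)) M)
              (M′ : Mk (plug κ s)) (ok′ : valid M′ false false ≡ true) where

  v : Fin (size (plug κ s))
  v = embed κ s (root s)

  reassemble : {H : Graph m} {h : Fin m} (J : ⟦ c ⟧ ≅ H) → J ⟪ root c ⟫ ≡ h →
    InO (attach ⟦ plug κ s ⟧ H v h) → InO ⟦ plug κ (s ▹ c) ⟧
  reassemble J e o = iso o (≅⇒Iso (≅-sym (≅-trans (plug-▹ κ s c) (attach-cong ≅-refl J refl e))))

  module _ (E : Mk c) (E-dom : dom E false ≡ true) (split : # M′ + # E ≤ # M) where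

    -- `S` and `E` together dominate the whole tree, hence have at least `# M` members. If the root
    -- of `c` is in `E`, it takes care of `v`, and `S` may leave `v` undominated. `E` is chosen for
    -- this count and may differ from the restriction of `M` to the piece.
    lower : ∀ S e → e ⇒ rootIn E → DominatesFrom ⟦ plug κ s ⟧ v e (lookup S) → # M′ ≤ ∣ S ∣
    lower S e le D with marks-surjective (plug κ (s ▹ c)) (Transfer.image (≅-sym (plug-▹ κ s c)) (S ++ marks E))
    ... | M″ , eq = +-cancelʳ-≤ (# E) (# M′) ∣ S ∣ (begin
      # M′ + # E                                                   ≤⟨ split ⟩
      # M                                                          ≤⟨ minimal ext M″ dominating-M″ ⟩
      # M″                                                         ≡⟨ ∣marks∣ M″ ⟨
      ∣ marks M″ ∣                                                 ≡⟨ cong ∣_∣ eq ⟩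
      ∣ Transfer.image (≅-sym (plug-▹ κ s c)) (S ++ marks E) ∣     ≡⟨ Transfer.∣image∣ (≅-sym (plug-▹ κ s c)) (S ++ marks E) ⟩
      ∣ S ++ marks E ∣                                             ≡⟨ ∣++∣ S (marks E) ⟩
      ∣ S ∣ + ∣ marks E ∣                                          ≡⟨ cong (∣ S ∣ +_) (∣marks∣ E) ⟩
      ∣ S ∣ + # E                                                  ∎)
      where
      open ≤-Reasoning
      dominating-M″ : dom M″ false ≡ true
      dominating-M″ = dominating⇒dom M″ (subst (Dominating _) (sym eq) (Transfer.dominating (≅-sym (plug-▹ κ s c))
        (attach-dominating v (root c) {S} {marks E} D (λ p → trans (rootIn-member E) (le p))
          (dominatesFrom-mono {S = marks E} (λ ()) (dom⇒ E E-dom)))))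

    bound : ∀ S → Dominating ⟦ plug κ s ⟧ S → # M′ ≤ ∣ S ∣
    bound S D = lower S false (λ ()) (dominatesFrom⇐ D)

    reduced : InO ⟦ plug κ s ⟧
    reduced = smaller ext (plug κ s) (size-plug-▹ κ s c) (gammaEq-marks M′ ok′ bound)

    almostEqGamma : rootIn E ≡ true → AlmostEqGamma ⟦ plug κ s ⟧ v
    almostEqGamma rE =
      # M′ , ((marks M′ , proj₁ (valid⇒semitotal M′ ok′) , ∣marks∣ M′) , bound) ,
        ((marks M′ , (λ w _ → proj₁ (valid⇒semitotal M′ ok′) w) , ∣marks∣ M′) ,
         λ S A → lower S true (λ _ → rE) (almost⇐ A))

-- The last hypothesis expresses that pruning the leaf does not lower γ. So `M′`, being no larger
-- than `M`, is as small as any dominating set of the pruned tree and thus a γt2-set through the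
-- attachment vertex.
leaf-rule : (κ : Ctx) (s : RT) {M : Mk (plug κ (s ▹ •))} → Extremal (plug κ (s ▹ •)) M →
  (M′ : Mk (plug κ s)) → valid M′ false false ≡ true → member M′ (embed κ s (root s)) ≡ true → # M′ ≤ # M →
  (∀ M″ → dom {plug κ s} M″ false ≡ true → ∃[ N ] (dom {plug κ (s ▹ •)} N false ≡ true × # N ≤ # M″)) →
  InO ⟦ plug κ (s ▹ •) ⟧
leaf-rule κ s ext M′ ok′ v∈M′ cheap extend = reassemble ≅-refl refl
  (op1 (smaller ext (plug κ s) (size-plug-▹ κ s •) (gammaEq-marks M′ ok′ low)) v
    (marks M′ , (valid⇒semitotal M′ ok′ , λ S sd → ≤-trans (≤-reflexive (∣marks∣ M′)) (low S (proj₁ sd))) ,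
     lookup⇒[]= v (marks M′) v∈M′))
  where
  open Reduce κ s • ext M′ ok′
  low : ∀ S → Dominating ⟦ plug κ s ⟧ S → # M′ ≤ ∣ S ∣
  low S D with marks-surjective (plug κ s) S
  ... | M″ , refl with extend M″ (dominating⇒dom M″ D)
  ...   | N , dN , le = ≤-trans cheap (≤-trans (minimal ext N dN) (≤-trans le (≤-reflexive (sym (∣marks∣ M″)))))

-- Small rooted trees and checks by enumeration

pattern S = • ▹ •
-- The subdivided star with two leaves rooted at its centre, P₄ rooted at an end, and P₄ rooted at
-- an inner vertex with its two branches in either order.
pattern X = (• ▹ S) ▹ S
pattern Q = • ▹ (• ▹ S)
pattern V₁ = S ▹ S
pattern V₂ = (• ▹ S) ▹ •

-- The markings that the scan retains: every pendant P₂ is covered from its upper vertex. In `θ` the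
-- first and the third vertex of the path are taken rather than the two inner ones, because members
-- are moved towards the root.
pattern σ = ⟨ true ⟩ ▹ ⟨ false ⟩
pattern ξ b = (⟨ b ⟩ ▹ σ) ▹ σ
pattern θ = ⟨ true ⟩ ▹ (⟨ false ⟩ ▹ σ)
pattern υ₁ = σ ▹ σ
pattern υ₂ = (⟨ true ⟩ ▹ σ) ▹ ⟨ false ⟩

finite-≅ : (G H : Graph n) (to from : Fin n → Fin n) → (∀ i → to (from i) ≡ i) → (∀ i → from (to i) ≡ i) →
  (∀ i j → G i j ≡ H (to i) (to j)) → G ≅ H
finite-≅ G H to from tf ft e = mk↔ₛ′ to from tf ft ,≅ e

S≅path2 : ⟦ S ⟧ ≅ path 2
S≅path2 = finite-≅ _ _ id id (λ _ → refl) (λ _ → refl)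
  (from-yes (all? λ i → all? λ j → ⟦ S ⟧ i j Bool.≟ path 2 i j))

Q≅path4 : ⟦ Q ⟧ ≅ path 4
Q≅path4 = finite-≅ _ _ id id (λ _ → refl) (λ _ → refl)
  (from-yes (all? λ i → all? λ j → ⟦ Q ⟧ i j Bool.≟ path 4 i j))

V₁≅path4 : ⟦ V₁ ⟧ ≅ path 4
V₁≅path4 = finite-≅ _ _ to from (from-yes (all? λ i → to (from i) ≟ i)) (from-yes (all? λ i → from (to i) ≟ i))
  (from-yes (all? λ i → all? λ j → ⟦ V₁ ⟧ i j Bool.≟ path 4 (to i) (to j)))
  where
  to from : Fin 4 → Fin 4
  to = lookup (1F ∷ 0F ∷ 2F ∷ 3F ∷ [])
  from = to

V₂≅path4 : ⟦ V₂ ⟧ ≅ path 4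
V₂≅path4 = finite-≅ _ _ to from (from-yes (all? λ i → to (from i) ≟ i)) (from-yes (all? λ i → from (to i) ≟ i))
  (from-yes (all? λ i → all? λ j → ⟦ V₂ ⟧ i j Bool.≟ path 4 (to i) (to j)))
  where
  to from : Fin 4 → Fin 4
  to = lookup (1F ∷ 2F ∷ 3F ∷ 0F ∷ [])
  from = lookup (3F ∷ 0F ∷ 1F ∷ 2F ∷ [])

•▹Q≅path5 : ⟦ • ▹ Q ⟧ ≅ path 5
•▹Q≅path5 = finite-≅ _ _ id id (λ _ → refl) (λ _ → refl)
  (from-yes (all? λ i → all? λ j → ⟦ • ▹ Q ⟧ i j Bool.≟ path 5 i j))

X≅subdividedStar2 : ⟦ X ⟧ ≅ subdividedStar 2
X≅subdividedStar2 = finite-≅ _ _ to from (from-yes (all? λ i → to (from i) ≟ i)) (from-yes (all? λ i → from (to i) ≟ i))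
  (from-yes (all? λ i → all? λ j → ⟦ X ⟧ i j Bool.≟ subdividedStar 2 (to i) (to j)))
  where
  to from : Fin 5 → Fin 5
  to = lookup (0F ∷ 1F ∷ 3F ∷ 2F ∷ 4F ∷ [])
  from = to

•▹V₁≅Y : ⟦ • ▹ V₁ ⟧ ≅ Ygraph
•▹V₁≅Y = finite-≅ _ _ id id (λ _ → refl) (λ _ → refl)
  (from-yes (all? λ i → all? λ j → ⟦ • ▹ V₁ ⟧ i j Bool.≟ Ygraph i j))

•▹V₂≅Y : ⟦ • ▹ V₂ ⟧ ≅ Ygraph
•▹V₂≅Y = finite-≅ _ _ to from (from-yes (all? λ i → to (from i) ≟ i)) (from-yes (all? λ i → from (to i) ≟ i))
  (from-yes (all? λ i → all? λ j → ⟦ • ▹ V₂ ⟧ i j Bool.≟ Ygraph (to i) (to j)))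
  where
  to from : Fin 5 → Fin 5
  to = lookup (0F ∷ 1F ∷ 3F ∷ 4F ∷ 2F ∷ [])
  from = lookup (0F ∷ 1F ∷ 4F ∷ 2F ∷ 3F ∷ [])

allMk : ∀ t → (Mk t → Bool) → Bool
allMk • f = f ⟨ true ⟩ ∧ f ⟨ false ⟩
allMk (t ▹ c) f = allMk t λ p → allMk c λ q → f (p ▹ q)

allMk-sound : ∀ t f → allMk t f ≡ true → ∀ m → f m ≡ true
allMk-sound • f e ⟨ true ⟩ = proj₁ (∧-true e)
allMk-sound • f e ⟨ false ⟩ = proj₂ (∧-true {f ⟨ true ⟩} e)
allMk-sound (t ▹ c) f e (p ▹ q) = allMk-sound c (λ q → f (p ▹ q)) (allMk-sound t (λ p → allMk c λ q → f (p ▹ q)) e p) q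

-- For a concrete tree all markings can be enumerated, so `check` is settled by `refl`.
dom-bound : ∀ s k e₁ → allMk s (λ m → not (dom m e₁) ∨ (k ≤ᵇ # m)) ≡ true → ∀ m → dom {s} m e₁ ≡ true → k ≤ # m
dom-bound s k e₁ check m d with ∨-true {not (dom m e₁)} (allMk-sound s _ check m)
... | inj₁ p = true≢false p (cong not d)
... | inj₂ p = ≤ᵇ⇒≤ k (# m) (subst T (sym p) _)

-- `N` contains the root and dominates on its own, so it can replace whatever a dominating set has
-- in the hole. By `check` it is not larger, even when the replaced part had its root dominated from
-- outside.
extend-locally : ∀ κ s s′ (N : Mk s′) → rootIn N ≡ true → dom N false ≡ true →
  allMk s (λ m → not (dom m true) ∨ (# N ≤ᵇ # m)) ≡ true →
  ∀ M″ → dom {plug κ s} M″ false ≡ true → ∃[ M ] (dom {plug κ s′} M false ≡ true × # M ≤ # M″)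
extend-locally κ s s′ N rN dN check M″ d with unplug κ s M″
... | K , p , refl with dom-split K p d
...   | o , dp = plugM K N , dom-join K N (domOut-mono K (λ _ → rN) o) (dom-mono N (λ ()) dN) ,
        ≤-trans (≤-reflexive (#-plug K N)) (≤-trans
          (+-monoʳ-≤ (cost K) (dom-bound s (# N) true check p (dom-mono p (λ _ → refl) dp)))
          (≤-reflexive (sym (#-plug K p))))

#-plug-mono : (K : MCtx κ) (p : Mk s) (q : Mk t) → # p ≤ # q → # plugM K p ≤ # plugM K q
#-plug-mono K p q h = ≤-trans (≤-reflexive (#-plug K p)) (≤-trans (+-monoʳ-≤ (cost K) h) (≤-reflexive (sym (#-plug K q))))

Locally : (s : RT) → MCtx κ → Mk s → Set
Locally {κ} s K m = Extremal (plug κ s) (plugM K m)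

module _ (K : MCtx κ) {p : Mk (s ▹ c)} (ext : Locally (s ▹ c) K p) (p′ : Mk s) (ok′ : valid (plugM K p′) false false ≡ true)
         (E : Mk c) (dE : dom E false ≡ true) (cheap : # p′ + # E ≤ # p) where

  module R = Reduce κ s c ext (plugM K p′) ok′

  total : # plugM K p′ + # E ≤ # plugM K p
  total = begin
    # plugM K p′ + # E       ≡⟨ cong (_+ # E) (#-plug K p′) ⟩
    cost K + # p′ + # E      ≡⟨ +-assoc (cost K) _ _ ⟩
    cost K + (# p′ + # E)    ≤⟨ +-monoʳ-≤ (cost K) cheap ⟩
    cost K + # p             ≡⟨ #-plug K p ⟨
    # plugM K p              ∎
    where open ≤-Reasoning

  path-rule : rootIn E ≡ true → {H : Graph m} {h : Fin m} (J : ⟦ c ⟧ ≅ H) → J ⟪ root c ⟫ ≡ h →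
    (∀ {n} {T : Graph n} → InO T → ∀ v → AlmostEqGamma T v → InO (attach T H v h)) → InO ⟦ plug κ (s ▹ c) ⟧
  path-rule rE J e op = R.reassemble J e (op (R.reduced E dE total) R.v (R.almostEqGamma E dE total rE))

  free-rule : {H : Graph m} {h : Fin m} (J : ⟦ c ⟧ ≅ H) → J ⟪ root c ⟫ ≡ h →
    (∀ {n} {T : Graph n} → InO T → ∀ v → InO (attach T H v h)) → InO ⟦ plug κ (s ▹ c) ⟧
  free-rule J e op = R.reassemble J e (op (R.reduced E dE total) R.v)

P2-rule : (K : MCtx κ) {p : Mk (s ▹ S)} → Locally (s ▹ S) K p → (p′ : Mk s) → valid (plugM K p′) false false ≡ true →
  # p′ + 1 ≤ # p → InO ⟦ plug κ (s ▹ S) ⟧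
P2-rule K ext p′ ok′ cheap = path-rule K ext p′ ok′ σ refl cheap refl S≅path2 refl op2a

swap : (K : MCtx κ) {m : Mk s} → Locally s K m → (m′ : Mk s) → valid (plugM K m′) false false ≡ true → # m′ ≤ # m → Locally s K m′
swap K {m} ext m′ v le = record
  { ok = v ; minimal = λ M′ d → ≤-trans (#-plug-mono K m′ m le) (minimal ext M′ d) ; smaller = smaller ext }

swap-root : (K : MCtx κ) {m : Mk s} → Locally s K m → (m′ : Mk s) → rootIn m′ ≡ true →
  (∀ e₁ e₂ → valid m e₁ e₂ ≡ true → valid m′ e₁ e₂ ≡ true) → # m′ ≤ # m → Locally s K m′
swap-root K {m} ext m′ rm′ vv le with valid-split K m (ok ext)
... | o , v = swap K ext m′ (valid-join K m′ (validOut-mono K (λ _ → rm′) (λ _ → ∨-introˡ rm′) o) (vv _ _ v)) le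

-- `m′` is compared with γ, so domination suffices; with the root in `m′`, no vertex of the context
-- loses its dominator.
wasteful : {A : Set} (K : MCtx κ) {m : Mk s} → Locally s K m → (m′ : Mk s) → rootIn m′ ≡ true → dom m′ false ≡ true → # m′ < # m → A
wasteful K {m} ext m′ rm′ d lt with dom-split K m (valid⇒dom (plugM K m) (ok ext))
... | o , _ = ⊥-elim (<⇒≱ (≤-trans (≤-reflexive (cong suc (#-plug K m′))) (≤-trans (+-monoʳ-< (cost K) lt) (≤-reflexive (sym (#-plug K m)))))
  (minimal ext (plugM K m′) (dom-join K m′ (domOut-mono K (λ _ → rm′) o) (dom-mono m′ (λ ()) d))))

-- The configurations that survive inside a tree with no applicable inverse operation.
data Small : ∀ {s} → Mk s → Set where
  leaf : ∀ b → Small ⟨ b ⟩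
  twig : Small σ
  stem : ∀ b → Small (⟨ b ⟩ ▹ σ)

-- Common to these, in contrast to `Small`: a member of the context next to the root makes them
-- reducible, as `reduce-big` shows.
data Big : ∀ {s} → Mk s → Set where
  v₁ : Big υ₁
  v₂ : Big υ₂
  xx : ∀ b → Big (ξ b)
  qq : Big θ
  pp : Big (⟨ false ⟩ ▹ θ)
  y₁ : Big (⟨ false ⟩ ▹ υ₁)
  y₂ : Big (⟨ false ⟩ ▹ υ₂)

Irreducible : Mk s → Set
Irreducible m = Small m ⊎ Big m

-- The hanging P₂ contains the only partner that the root has inside the subtree. A member of the
-- context within distance 2 takes over this part, and the P₂ can go.
reduce-V₁ : (K : MCtx κ) → Locally V₁ K υ₁ → near₁ K ∨ near₂ K ≡ true → InO ⟦ plug κ V₁ ⟧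
reduce-V₁ K ext near with valid-split K υ₁ (ok ext)
... | o , v = P2-rule K ext σ (valid-join K σ (validOut-mono K (λ _ → refl) (λ _ → refl) o) (check (near₁ K) (near₂ K) near)) ≤-refl
  where
  check : ∀ e₁ e₂ → e₁ ∨ e₂ ≡ true → valid σ e₁ e₂ ≡ true
  check true _ _ = refl
  check false true _ = refl

reduce-V₂ : (K : MCtx κ) → Locally V₂ K υ₂ → near₁ K ∨ near₂ K ≡ true → InO ⟦ plug κ V₂ ⟧
reduce-V₂ K ext near with valid-split K υ₂ (ok ext)
... | o , v = P2-rule (K ◃▹ ⟨ false ⟩) ext ⟨ true ⟩
    (valid-join K σ (validOut-mono K (λ _ → refl) (λ _ → refl) o) (check (near₁ K) (near₂ K) near)) ≤-refl
  where
  check : ∀ e₁ e₂ → e₁ ∨ e₂ ≡ true → valid σ e₁ e₂ ≡ true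
  check true _ _ = refl
  check false true _ = refl

reduce-Q : (K : MCtx κ) → Locally Q K θ → near₁ K ∨ near₂ K ≡ true → InO ⟦ plug κ Q ⟧
reduce-Q K ext near with valid-split K θ (ok ext)
... | o , v = P2-rule (K ▹◃ ⟨ true ⟩) ext ⟨ false ⟩
    (valid-join K σ (validOut-mono K (λ _ → refl) (λ _ → refl) o) (check (near₁ K) (near₂ K) near)) ≤-refl
  where
  check : ∀ e₁ e₂ → e₁ ∨ e₂ ≡ true → valid σ e₁ e₂ ≡ true
  check true _ _ = refl
  check false true _ = refl

-- With one leg gone, the member on the other leg finds a partner at the centre or, through the
-- centre, in the context.
reduce-X : ∀ b (K : MCtx κ) → Locally X K (ξ b) → b ∨ near₁ K ≡ true → InO ⟦ plug κ X ⟧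
reduce-X b K ext near with valid-split K (ξ b) (ok ext)
... | o , v = P2-rule K ext (⟨ b ⟩ ▹ σ) (valid-join K (⟨ b ⟩ ▹ σ) o (check b (near₁ K) (near₂ K) near)) (≤-reflexive refl)
  where
  check : ∀ b e₁ e₂ → b ∨ e₁ ≡ true → valid (⟨ b ⟩ ▹ σ) e₁ e₂ ≡ true
  check true true _ _ = refl
  check true false _ _ = refl
  check false true _ _ = refl

reduce-big : {m : Mk s} → Big m → (K : MCtx κ) → Locally s K m → near₁ K ≡ true → InO ⟦ plug κ s ⟧
reduce-big v₁ K ext near = reduce-V₁ K ext (∨-introˡ near)
reduce-big v₂ K ext near = reduce-V₂ K ext (∨-introˡ near)
reduce-big (xx b) K ext near = reduce-X b K ext (∨-introʳ {b} near)
reduce-big qq K ext near = reduce-Q K ext (∨-introˡ near)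
reduce-big pp K ext near = reduce-Q (K ▹◃ ⟨ false ⟩) ext near
reduce-big y₁ K ext near = reduce-V₁ (K ▹◃ ⟨ false ⟩) ext near
reduce-big y₂ K ext near = reduce-V₂ (K ▹◃ ⟨ false ⟩) ext near

-- Two members on different sides of the cut edge and within distance 2 would include an end of this
-- edge. Both ends are unmarked, so neither domination nor pairing crosses the cut.
cut-valid : (K : MCtx κ) (p : Mk s) (q : Mk c) → rootIn p ≡ false → rootIn q ≡ false →
  valid (plugM K (p ▹ q)) false false ≡ true → valid (plugM K p) false false ≡ true
cut-valid K p q rp rq v with valid-split (K ◃▹ q) p v
... | o , vp with ∧-true {validOut K (rootIn p) (childIn p ∨ rootIn q)} o
...   | o′ , _ rewrite rq = valid-join K p (subst (λ z → validOut K (rootIn p) z ≡ true) (∨-identityʳ (childIn p)) o′)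
        (subst (λ z → valid p z (near₂ K) ≡ true) (∨-identityʳ (near₁ K)) (valid-unmarked p rp vp))

drop-leaf-valid : (K : MCtx κ) (p : Mk s) → valid (plugM K (p ▹ ⟨ false ⟩)) false false ≡ true → valid (plugM K p) false false ≡ true
drop-leaf-valid K p v with valid-split (K ◃▹ ⟨ false ⟩) p v
... | o , vp with ∧-true {validOut K (rootIn p) (childIn p ∨ false)} o
...   | o′ , _ = valid-join K p (subst (λ z → validOut K (rootIn p) z ≡ true) (∨-identityʳ (childIn p)) o′)
        (subst₂ (λ y z → valid p y z ≡ true) (∨-identityʳ (near₁ K)) (∨-identityʳ (near₂ K)) vp)

root-leaf-rule : (K : MCtx κ) (p : Mk s) → Locally (s ▹ •) K (p ▹ ⟨ false ⟩) → rootIn p ≡ true → dom (p ▹ ⟨ false ⟩) false ≡ true →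
  allMk s (λ m → not (dom m true) ∨ (# (p ▹ ⟨ false ⟩) ≤ᵇ # m)) ≡ true → InO ⟦ plug κ (s ▹ •) ⟧
root-leaf-rule {κ} {s} K p ext rp dp check = leaf-rule κ s ext (plugM K p) (drop-leaf-valid K p (ok ext))
  (trans (member-embed K p (root s)) (trans (rootIn-member p) rp))
  (#-plug-mono K p (p ▹ ⟨ false ⟩) (m≤m+n (# p) 0))
  (extend-locally κ s (s ▹ •) (p ▹ ⟨ false ⟩) rp dp check)

-- The pruned leaf is the far end of the pendant path; the other leaf forces a second member and so keeps γ from dropping.
twig-stem-rule : (K : MCtx κ) → Locally (S ▹ (• ▹ S)) K (σ ▹ (⟨ false ⟩ ▹ σ)) → InO ⟦ plug κ (S ▹ (• ▹ S)) ⟧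
twig-stem-rule {κ} K ext with valid-split K (σ ▹ (⟨ false ⟩ ▹ σ)) (ok ext)
... | o , _ = leaf-rule (κ ▹◃ S ▹◃ •) • ext (plugM K M′) (valid-join K M′ o (valid-anywhere M′ refl (near₁ K) (near₂ K)))
    (member-embed (K ▹◃ σ ▹◃ ⟨ false ⟩) ⟨ true ⟩ 0F) (#-plug-mono K M′ (σ ▹ (⟨ false ⟩ ▹ σ)) ≤-refl)
    (extend-locally κ (S ▹ S) (S ▹ (• ▹ S)) (σ ▹ (⟨ false ⟩ ▹ σ)) refl refl refl)
  where
  M′ : Mk (S ▹ S)
  M′ = σ ▹ (⟨ false ⟩ ▹ ⟨ true ⟩)

-- The rooted tree of `twig-stem-rule` with its branches in the other order. Pruning the leaf at the
-- root by `root-leaf-rule` would fail its check: once the root is dominated from outside, the third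
-- vertex alone dominates `Q`.
Q-leaf-rule : (K : MCtx κ) → Locally (Q ▹ •) K (θ ▹ ⟨ false ⟩) → InO ⟦ plug κ (Q ▹ •) ⟧
Q-leaf-rule {κ} K ext with valid-split K (θ ▹ ⟨ false ⟩) (ok ext)
... | o , _ = leaf-rule (κ ◃▹ • ▹◃ • ▹◃ •) • ext (plugM K M′) (valid-join K M′ o (valid-anywhere M′ refl (near₁ K) (near₂ K)))
    (member-embed (K ◃▹ ⟨ false ⟩ ▹◃ ⟨ true ⟩ ▹◃ ⟨ false ⟩) ⟨ true ⟩ 0F) (#-plug-mono K M′ (θ ▹ ⟨ false ⟩) ≤-refl)
    (extend-locally κ ((• ▹ S) ▹ •) (Q ▹ •) (θ ▹ ⟨ false ⟩) refl refl refl)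
  where
  M′ : Mk ((• ▹ S) ▹ •)
  M′ = (⟨ true ⟩ ▹ (⟨ false ⟩ ▹ ⟨ true ⟩)) ▹ ⟨ false ⟩

leaf-needs-root : (K : MCtx κ) (p : Mk s) → Locally (s ▹ •) K (p ▹ ⟨ false ⟩) → rootIn p ≡ true
leaf-needs-root K p ext = proj₁ (∧-true {rootIn p} (proj₂ (valid-split (K ▹◃ p) ⟨ false ⟩ (ok ext))))

-- The only member of the stem needs a partner within distance 2, and outside the stem only the
-- parent is that close.
stem-needs-root : (K : MCtx κ) (p : Mk s) → Locally (s ▹ (• ▹ S)) K (p ▹ (⟨ false ⟩ ▹ σ)) → rootIn p ≡ true
stem-needs-root K p ext = check (rootIn p) (near₂ (K ▹◃ p)) (proj₂ (valid-split (K ▹◃ p) (⟨ false ⟩ ▹ σ) (ok ext)))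
  where
  check : ∀ b e → valid (⟨ false ⟩ ▹ σ) b e ≡ true → b ≡ true
  check true _ _ = refl

big-leaf : {p : Mk s} → Big p → (K : MCtx κ) → Locally (s ▹ •) K (p ▹ ⟨ false ⟩) → InO ⟦ plug κ (s ▹ •) ⟧
big-leaf v₁ K ext = root-leaf-rule K υ₁ ext refl refl refl
big-leaf v₂ K ext = root-leaf-rule K υ₂ ext refl refl refl
big-leaf (xx true) K ext = reduce-X true (K ◃▹ ⟨ false ⟩) ext refl
big-leaf (xx false) K ext = true≢false (leaf-needs-root K (ξ false) ext) refl
big-leaf qq K ext = Q-leaf-rule K ext
big-leaf pp K ext = true≢false (leaf-needs-root K (⟨ false ⟩ ▹ θ) ext) refl
big-leaf y₁ K ext = true≢false (leaf-needs-root K (⟨ false ⟩ ▹ υ₁) ext) refl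
big-leaf y₂ K ext = true≢false (leaf-needs-root K (⟨ false ⟩ ▹ υ₂) ext) refl

-- The member of the hanging stem is at distance 2 from the root, near enough to be the partner that
-- a marked root needs when it gives up a P₂.
big-stem : {p : Mk s} → Big p → (K : MCtx κ) → Locally (s ▹ (• ▹ S)) K (p ▹ (⟨ false ⟩ ▹ σ)) → InO ⟦ plug κ (s ▹ (• ▹ S)) ⟧
big-stem {κ = κ} B K ext with near
  where
  near : near₁ (K ◃▹ (⟨ false ⟩ ▹ σ)) ∨ near₂ (K ◃▹ (⟨ false ⟩ ▹ σ)) ≡ true
  near = ∨-introʳ {near₁ K ∨ false} (∨-zeroʳ (near₂ K))
big-stem v₁ K ext | near = reduce-V₁ (K ◃▹ (⟨ false ⟩ ▹ σ)) ext near
big-stem v₂ K ext | near = reduce-V₂ (K ◃▹ (⟨ false ⟩ ▹ σ)) ext near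
big-stem qq K ext | near = reduce-Q (K ◃▹ (⟨ false ⟩ ▹ σ)) ext near
big-stem (xx true) K ext | _ = reduce-X true (K ◃▹ (⟨ false ⟩ ▹ σ)) ext refl
big-stem (xx false) K ext | _ = true≢false (stem-needs-root K (ξ false) ext) refl
big-stem pp K ext | _ = true≢false (stem-needs-root K (⟨ false ⟩ ▹ θ) ext) refl
big-stem y₁ K ext | _ = true≢false (stem-needs-root K (⟨ false ⟩ ▹ υ₁) ext) refl
big-stem y₂ K ext | _ = true≢false (stem-needs-root K (⟨ false ⟩ ▹ υ₂) ext) refl

cut-X : ∀ b (K : MCtx κ) (p : Mk s) → Locally (s ▹ X) K (p ▹ ξ b) → InO ⟦ plug κ (s ▹ X) ⟧
cut-X true K p ext = reduce-X true (K ▹◃ p) ext refl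
cut-X false K p ext with rootIn p in e
... | true = reduce-X false (K ▹◃ p) ext e
... | false = free-rule K ext p (cut-valid K p (ξ false) e refl (ok ext)) (ξ false) refl ≤-refl X≅subdividedStar2 refl
      (λ o v → op3 o 2 ≤-refl v)

cut-P5 : (K : MCtx κ) (p : Mk s) → Locally (s ▹ (• ▹ Q)) K (p ▹ (⟨ false ⟩ ▹ θ)) → InO ⟦ plug κ (s ▹ (• ▹ Q)) ⟧
cut-P5 K p ext with rootIn p in e
... | true = reduce-Q (K ▹◃ p ▹◃ ⟨ false ⟩) ext e
... | false = path-rule K ext p (cut-valid K p (⟨ false ⟩ ▹ θ) e refl (ok ext))
      -- The first and the fourth vertex dominate P₅ as cheaply as the second and the fourth do, and
      -- the first is the attached end, as `path-rule` requires.
      (⟨ true ⟩ ▹ (⟨ false ⟩ ▹ (⟨ false ⟩ ▹ σ))) refl ≤-refl refl •▹Q≅path5 refl op2b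

cut-Y₁ : (K : MCtx κ) (p : Mk s) → Locally (s ▹ (• ▹ V₁)) K (p ▹ (⟨ false ⟩ ▹ υ₁)) → InO ⟦ plug κ (s ▹ (• ▹ V₁)) ⟧
cut-Y₁ K p ext with rootIn p in e
... | true = reduce-V₁ (K ▹◃ p ▹◃ ⟨ false ⟩) ext e
... | false = free-rule K ext p (cut-valid K p (⟨ false ⟩ ▹ υ₁) e refl (ok ext)) (⟨ false ⟩ ▹ υ₁) refl ≤-refl •▹V₁≅Y refl op4

cut-Y₂ : (K : MCtx κ) (p : Mk s) → Locally (s ▹ (• ▹ V₂)) K (p ▹ (⟨ false ⟩ ▹ υ₂)) → InO ⟦ plug κ (s ▹ (• ▹ V₂)) ⟧
cut-Y₂ K p ext with rootIn p in e
... | true = reduce-V₂ (K ▹◃ p ▹◃ ⟨ false ⟩) ext e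
... | false = free-rule K ext p (cut-valid K p (⟨ false ⟩ ▹ υ₂) e refl (ok ext)) (⟨ false ⟩ ▹ υ₂) refl ≤-refl •▹V₂≅Y refl op4

-- The bottom-up scan

Outcome : (s : RT) → MCtx κ → Set
Outcome {κ} s K = InO ⟦ plug κ s ⟧ ⊎ ∃[ m ] (Locally s K m × Irreducible m)

combine : (K : MCtx κ) {p : Mk s} {q : Mk c} → Irreducible p → Irreducible q → Locally (s ▹ c) K (p ▹ q) → Outcome (s ▹ c) K
combine K _ (inj₂ (xx b)) ext = inj₁ (cut-X b K _ ext)
combine K _ (inj₂ pp) ext = inj₁ (cut-P5 K _ ext)
combine K _ (inj₂ y₁) ext = inj₁ (cut-Y₁ K _ ext)
combine K _ (inj₂ y₂) ext = inj₁ (cut-Y₂ K _ ext)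
-- The marked root of the new branch is the member next to the root that `reduce-big` asks for.
combine K (inj₂ B) (inj₁ (leaf true)) ext = inj₁ (reduce-big B (K ◃▹ _) ext (∨-zeroʳ (near₁ K)))
combine K (inj₂ B) (inj₁ twig) ext = inj₁ (reduce-big B (K ◃▹ _) ext (∨-zeroʳ (near₁ K)))
combine K (inj₂ B) (inj₁ (stem true)) ext = inj₁ (reduce-big B (K ◃▹ _) ext (∨-zeroʳ (near₁ K)))
combine K (inj₂ B) (inj₂ v₁) ext = inj₁ (reduce-big B (K ◃▹ _) ext (∨-zeroʳ (near₁ K)))
combine K (inj₂ B) (inj₂ v₂) ext = inj₁ (reduce-big B (K ◃▹ _) ext (∨-zeroʳ (near₁ K)))
combine K (inj₂ B) (inj₂ qq) ext = inj₁ (reduce-big B (K ◃▹ _) ext (∨-zeroʳ (near₁ K)))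
combine K (inj₂ B) (inj₁ (leaf false)) ext = inj₁ (big-leaf B K ext)
combine K (inj₂ B) (inj₁ (stem false)) ext = inj₁ (big-stem B K ext)
combine K (inj₁ (leaf true)) (inj₁ (leaf false)) ext = inj₂ (_ , ext , inj₁ twig)
combine K (inj₁ (leaf true)) (inj₁ (leaf true)) ext = wasteful K ext σ refl refl ≤-refl
combine K (inj₁ (leaf false)) (inj₁ (leaf true)) ext =
  inj₂ (_ , swap-root K ext σ refl (λ { true _ _ → refl ; false true () ; false false () }) ≤-refl , inj₁ twig)
combine K (inj₁ (leaf false)) (inj₁ (leaf false)) ext = true≢false (leaf-needs-root K ⟨ false ⟩ ext) refl
combine K (inj₁ (leaf b)) (inj₁ twig) ext = inj₂ (_ , ext , inj₁ (stem b))
combine K (inj₁ (leaf true)) (inj₁ (stem false)) ext = inj₂ (_ , ext , inj₂ qq)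
combine K (inj₁ (leaf true)) (inj₁ (stem true)) ext = wasteful K ext θ refl refl ≤-refl
-- Members at the two inner vertices of P₄ move to the first and the third, the exchange from which
-- `θ` arises.
combine K (inj₁ (leaf false)) (inj₁ (stem true)) ext =
  inj₂ (_ , swap-root K ext θ refl (λ e₁ e₂ _ → valid-anywhere θ refl e₁ e₂) ≤-refl , inj₂ qq)
combine K (inj₁ (leaf false)) (inj₁ (stem false)) ext = true≢false (stem-needs-root K ⟨ false ⟩ ext) refl
combine K (inj₁ (leaf true)) (inj₂ v₁) ext = inj₁ (reduce-V₁ (K ▹◃ ⟨ true ⟩) ext refl)
combine K (inj₁ (leaf false)) (inj₂ v₁) ext = inj₂ (_ , ext , inj₂ y₁)
combine K (inj₁ (leaf true)) (inj₂ v₂) ext = inj₁ (reduce-V₂ (K ▹◃ ⟨ true ⟩) ext refl)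
combine K (inj₁ (leaf false)) (inj₂ v₂) ext = inj₂ (_ , ext , inj₂ y₂)
combine K (inj₁ (leaf true)) (inj₂ qq) ext = inj₁ (reduce-Q (K ▹◃ ⟨ true ⟩) ext refl)
combine K (inj₁ (leaf false)) (inj₂ qq) ext = inj₂ (_ , ext , inj₂ pp)
combine K (inj₁ twig) (inj₁ (leaf false)) ext = inj₁ (root-leaf-rule K σ ext refl refl refl)
combine K (inj₁ twig) (inj₁ (leaf true)) ext = wasteful K ext (σ ▹ ⟨ false ⟩) refl refl ≤-refl
combine K (inj₁ twig) (inj₁ twig) ext = inj₂ (_ , ext , inj₂ v₁)
combine K (inj₁ twig) (inj₁ (stem false)) ext = inj₁ (twig-stem-rule K ext)
combine K (inj₁ twig) (inj₁ (stem true)) ext = wasteful K ext (σ ▹ (⟨ false ⟩ ▹ σ)) refl refl ≤-refl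
combine K (inj₁ twig) (inj₂ v₁) ext = inj₁ (reduce-V₁ (K ▹◃ σ) ext refl)
combine K (inj₁ twig) (inj₂ v₂) ext = inj₁ (reduce-V₂ (K ▹◃ σ) ext refl)
combine K (inj₁ twig) (inj₂ qq) ext = inj₁ (reduce-Q (K ▹◃ σ) ext refl)
combine K (inj₁ (stem true)) (inj₁ (leaf false)) ext = inj₂ (_ , ext , inj₂ v₂)
combine K (inj₁ (stem true)) (inj₁ (leaf true)) ext = wasteful K ext υ₂ refl refl ≤-refl
combine K (inj₁ (stem false)) (inj₁ (leaf true)) ext =
  inj₂ (_ , swap-root K ext υ₂ refl (λ e₁ e₂ _ → valid-anywhere υ₂ refl e₁ e₂) ≤-refl , inj₂ v₂)
combine K (inj₁ (stem false)) (inj₁ (leaf false)) ext = true≢false (leaf-needs-root K (⟨ false ⟩ ▹ σ) ext) refl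
combine K (inj₁ (stem b)) (inj₁ twig) ext = inj₂ (_ , ext , inj₂ (xx b))
-- The two members of the second branch are partners of each other and dominate the root, so the P₂
-- of the first branch can go.
combine K (inj₁ (stem b)) (inj₁ (stem true)) ext = inj₁ (P2-rule (K ◃▹ (⟨ true ⟩ ▹ σ)) ext ⟨ b ⟩
  (valid-join K (⟨ b ⟩ ▹ (⟨ true ⟩ ▹ σ)) (proj₁ (valid-split K ((⟨ b ⟩ ▹ σ) ▹ (⟨ true ⟩ ▹ σ)) (ok ext))) (check b)) ≤-refl)
  where
  check : ∀ b → valid (⟨ b ⟩ ▹ (⟨ true ⟩ ▹ σ)) (near₁ K) (near₂ K) ≡ true
  check true = valid-anywhere (⟨ true ⟩ ▹ (⟨ true ⟩ ▹ σ)) refl (near₁ K) (near₂ K)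
  check false = valid-anywhere (⟨ false ⟩ ▹ (⟨ true ⟩ ▹ σ)) refl (near₁ K) (near₂ K)
combine K (inj₁ (stem true)) (inj₁ (stem false)) ext = inj₁ (P2-rule (K ▹◃ (⟨ true ⟩ ▹ σ)) ext ⟨ false ⟩
  (valid-join K υ₂ (proj₁ (valid-split K ((⟨ true ⟩ ▹ σ) ▹ (⟨ false ⟩ ▹ σ)) (ok ext))) (valid-anywhere υ₂ refl (near₁ K) (near₂ K))) ≤-refl)
combine K (inj₁ (stem false)) (inj₁ (stem false)) ext = true≢false (stem-needs-root K (⟨ false ⟩ ▹ σ) ext) refl
combine K (inj₁ (stem b)) (inj₂ v₁) ext = inj₁ (reduce-V₁ (K ▹◃ (⟨ b ⟩ ▹ σ)) ext (∨-zeroʳ b))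
combine K (inj₁ (stem b)) (inj₂ v₂) ext = inj₁ (reduce-V₂ (K ▹◃ (⟨ b ⟩ ▹ σ)) ext (∨-zeroʳ b))
combine K (inj₁ (stem b)) (inj₂ qq) ext = inj₁ (reduce-Q (K ▹◃ (⟨ b ⟩ ▹ σ)) ext (∨-zeroʳ b))

-- The branch is scanned while the rest is still untouched context. `Irreducible` speaks only of the
-- marking inside the branch, so it survives later exchanges in the rest.
classify : ∀ s (K : MCtx κ) (m : Mk s) → Locally s K m → Outcome s K
classify • K ⟨ b ⟩ ext = inj₂ (_ , ext , inj₁ (leaf b))
classify (t ▹ c) K (p ▹ q) ext with classify c (K ▹◃ p) q ext
... | inj₁ o = inj₁ o
... | inj₂ (q′ , ext′ , C) with classify t (K ◃▹ q′) p ext′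
...   | inj₁ o = inj₁ o
...   | inj₂ (p′ , ext″ , P) = combine K P C ext″

base-rule : ∀ s → ⟦ s ⟧ ≅ path 4 → InO ⟦ s ⟧
base-rule _ J = iso base (≅⇒Iso (≅-sym J))

-- Without a context two members are needed, which leaves only `stem true` among `Small`, and this
-- is excluded by γ(P₃) = 1. A five-vertex tree with unmarked root loses a leaf and becomes P₄,
-- whose domination number is 2 as well.
irreducible⇒InO : {m : Mk s} → Irreducible m → Extremal s m → InO ⟦ s ⟧
irreducible⇒InO (inj₁ (leaf true)) ext with ok ext
... | ()
irreducible⇒InO (inj₁ (leaf false)) ext with ok ext
... | ()
irreducible⇒InO (inj₁ twig) ext with ok ext
... | ()
irreducible⇒InO (inj₁ (stem true)) ext with minimal ext (⟨ false ⟩ ▹ σ) refl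
... | s≤s ()
irreducible⇒InO (inj₁ (stem false)) ext with ok ext
... | ()
irreducible⇒InO (inj₂ v₁) ext = base-rule V₁ V₁≅path4
irreducible⇒InO (inj₂ v₂) ext = base-rule V₂ V₂≅path4
irreducible⇒InO (inj₂ qq) ext = base-rule Q Q≅path4
irreducible⇒InO (inj₂ (xx true)) ext = reduce-X true top ext refl
irreducible⇒InO (inj₂ (xx false)) ext = leaf-rule (top ▹◃ (• ▹ S)) • ext ((⟨ false ⟩ ▹ σ) ▹ ⟨ true ⟩) refl refl ≤-refl
  (λ M d → ξ false , refl , dom-bound V₂ 2 false refl M d)
irreducible⇒InO (inj₂ pp) ext = leaf-rule (top ▹◃ • ▹◃ • ▹◃ •) • ext (⟨ false ⟩ ▹ (⟨ true ⟩ ▹ (⟨ false ⟩ ▹ ⟨ true ⟩))) refl refl ≤-refl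
  (λ M d → ⟨ false ⟩ ▹ θ , refl , dom-bound Q 2 false refl M d)
irreducible⇒InO (inj₂ y₁) ext = leaf-rule (top ▹◃ • ◃▹ S) • ext (⟨ false ⟩ ▹ (⟨ true ⟩ ▹ σ)) refl refl ≤-refl
  (λ M d → ⟨ false ⟩ ▹ υ₁ , refl , dom-bound Q 2 false refl M d)
irreducible⇒InO (inj₂ y₂) ext = leaf-rule (top ▹◃ •) (• ▹ S) ext (⟨ false ⟩ ▹ (⟨ true ⟩ ▹ σ)) refl refl ≤-refl
  (λ M d → ⟨ false ⟩ ▹ υ₂ , refl , dom-bound Q 2 false refl M d)

-- Induction on a bound for the size, since the removed pieces vary in size.
gammaEq⇒InO : ∀ b t → size t < b → GammaEqGammaT2 ⟦ t ⟧ → InO ⟦ t ⟧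
gammaEq⇒InO (suc b) t (s≤s t≤b) (k , (_ , low) , ((D , SD , ∣D∣) , _)) with marks-surjective t D
... | M , refl with classify t top M ext
  where
  ext : Extremal t M
  ext = record
    { ok = semitotal⇒valid M SD
    ; minimal = λ M′ d → ≤-trans (≤-reflexive (trans (sym (∣marks∣ M)) ∣D∣))
                           (≤-trans (low (marks M′) (dom⇒dominating M′ d)) (≤-reflexive (∣marks∣ M′)))
    ; smaller = λ t′ lt → gammaEq⇒InO b t′ (≤-trans lt t≤b)
    }
...   | inj₁ o = o
...   | inj₂ (_ , ext′ , I) = irreducible⇒InO I ext′

theorem3p3 : ∀ {n : ℕ} (T : Graph n) → IsTree T → (GammaEqGammaT2 T ⇔ InO T)
theorem3p3 T tree with rooted tree
... | t , I = mk⇔ (λ g → iso (gammaEq⇒InO _ t ≤-refl (gammaEq-≅ (≅-sym I) g)) (≅⇒Iso I)) InO⇒gammaEq
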